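{- For every $n\ge 4$, the matching polytope $P_M(W_n)$ of the wheel graph $W_n$ has the integer decomposition property.
   Context: The wheel graph $W_n$ ($n\ge4$) has vertex set $\mathbb{Z}_{n-1}\sqcup\{v\}$ and edges $\{i,i+1\}$ and $\{i,v\}$ for $i\in\mathbb{Z}_{n-1}$ (a cycle of length $n-1$ plus a central vertex joined to every cycle vertex). For a graph $G$ with edge set $E$, the matching polytope $P_M(G)\subset\mathbb{R}^E$ is the convex hull of the indicator vectors of all matchings of $G$. A lattice polytope $P\subset\mathbb{R}^d$ has the integer decomposition property if for every $t\in\mathbb{Z}_{>0}$ and every $\alpha\in tP\cap\mathbb{Z}^d$ there exist $\alpha_1,\dots,\alpha_t\in P\cap\mathbb{Z}^d$ with $\alpha=\alpha_1+\cdots+\alpha_t$.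
   Formalization: The convex hull defining the matching polytope (and its dilations) is taken with rational rather than real weights; for lattice points this gives the same membership, by Carathéodory's theorem and Cramer's rule. -}

module Defs where

open import Data.Nat as ℕ using (ℕ; zero; suc; _∸_)
open import Data.Nat.DivMod using (_mod_)
open import Data.Integer as ℤ using (ℤ)
open import Data.Rational as ℚ using (ℚ; 0ℚ; 1ℚ)
open import Data.Fin using (Fin; toℕ)
open import Data.Bool using (Bool; true; false; T; if_then_else_)
open import Data.Unit using (⊤; tt)
open import Data.Sum using (_⊎_; inj₁; inj₂)
open import Data.Product using (Σ; ∃; _×_; _,_; proj₁; proj₂)
open import Data.List using (List; map; foldr)
open import Data.List.Relation.Unary.All as List using ()
open import Data.Vec as Vec using (Vec)
open import Data.Vec.Relation.Unary.All as VecAll using ()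
open import Relation.Binary.PropositionalEquality using (_≡_; _≢_)
open import Relation.Nullary using (¬_)

record Graph : Set₁ where
  field
    V : Set
    E : Set
    ends : E → V × V
open Graph public

_∈ₑ_ : {G : Graph} → V G → E G → Set
_∈ₑ_ {G} x e = (x ≡ proj₁ (ends G e)) ⊎ (x ≡ proj₂ (ends G e))

IsMatching : (G : Graph) → (E G → Bool) → Set
IsMatching G M = ∀ (e f : E G) → e ≢ f → T (M e) → T (M f) →
                 ∀ (x : V G) → _∈ₑ_ {G} x e → ¬ (_∈ₑ_ {G} x f)

Matching : Graph → Set
Matching G = Σ (E G → Bool) (IsMatching G)

indicator : {G : Graph} → Matching G → E G → ℚ
indicator (M , _) e = if M e then 1ℚ else 0ℚ

sumℚ : List ℚ → ℚ
sumℚ = foldr ℚ._+_ 0ℚ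

ℕ→ℚ : ℕ → ℚ
ℕ→ℚ t = ℤ.+ t ℚ./ 1

ℤ→ℚ : ℤ → ℚ
ℤ→ℚ z = z ℚ./ 1

-- x ∈ t · P_M(G), where P_M(G) = conv{ indicator vectors of matchings }:
-- x is a nonnegative (rational) combination of indicator vectors of matchings
-- with total weight t.
InDilatedMatchingPolytope : (G : Graph) → ℕ → (E G → ℚ) → Set
InDilatedMatchingPolytope G t x =
  ∃ λ (L : List (ℚ × Matching G)) →
      List.All (λ p → 0ℚ ℚ.≤ proj₁ p) L
    × sumℚ (map proj₁ L) ≡ ℕ→ℚ t
    × (∀ e → sumℚ (map (λ p → proj₁ p ℚ.* indicator {G} (proj₂ p) e) L) ≡ x e)

InMatchingPolytope : (G : Graph) → (E G → ℚ) → Set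
InMatchingPolytope G = InDilatedMatchingPolytope G 1

sumVecs : {E : Set} {t : ℕ} → Vec (E → ℤ) t → E → ℤ
sumVecs as e = Vec.foldr _ (λ a s → a e ℤ.+ s) (ℤ.+ 0) as

MatchingPolytopeHasIDP : Graph → Set
MatchingPolytopeHasIDP G =
  ∀ (t : ℕ) → 0 ℕ.< t → ∀ (α : E G → ℤ) →
    InDilatedMatchingPolytope G t (λ e → ℤ→ℚ (α e)) →
    ∃ λ (as : Vec (E G → ℤ) t) →
        VecAll.All (λ a → InMatchingPolytope G (λ e → ℤ→ℚ (a e))) as
      × (∀ e → sumVecs as e ≡ α e)

next : ∀ {m} → Fin m → Fin m
next {suc k} i = suc (toℕ i) mod (suc k)

Wheel : ℕ → Graph
Wheel n = record
  { V = Fin (n ∸ 1) ⊎ ⊤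
  ; E = Fin (n ∸ 1) ⊎ Fin (n ∸ 1)
  ; ends = λ { (inj₁ i) → (inj₁ i , inj₁ (next i))
             ; (inj₂ i) → (inj₁ i , inj₂ tt) }
  }

{-# OPTIONS --safe #-}
module Submission where

-- Colour the edges with t colours, each colour class a matching. A matching has at most one spoke, so the colours fall
-- into classes: s_k colours carry spoke k, and the remaining t − Σ s_k form class ∞. Going around the rim, give rim
-- edge j + 1 the c_{j+1} colours whose class is blocked again soonest at even distance, then class ∞, then the others
-- in reverse; this preference order is reversed from one rim edge to the next. The resulting map on prefix counts is
-- monotone, so iterating full rounds from the top state decreases to an integral periodic solution, and this solution
-- dominates the given fractional one, so no rim edge runs out of colours. Within one class the counts are those of a
-- multicolouring of a path or, for class ∞, of the rim cycle, which is split into matchings by assigning circular arcs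
-- of colours. On an odd rim this needs Σ x∞ ≤ (t − Σ s_k) ⌊m/2⌋. It is clear if class ∞ avoids some rim edge;
-- otherwise the greedy choice is tight everywhere, and summing it around the rim reduces the bound to the odd-cycle
-- inequality Σ c_j ≤ t ⌊m/2⌋.

open import Defs
open import Data.Nat
open import Data.Nat.Properties
open import Data.Nat.DivMod
open import Data.Nat.Tactic.RingSolver using (solve-∀)
open import Data.Integer as ℤ using (ℤ)
import Data.Integer.Properties as ℤₚ
open import Data.Rational as ℚ using (ℚ; mkℚ; 0ℚ; 1ℚ; toℚᵘ)
import Data.Rational.Properties as ℚₚ
open import Data.Rational.Solver using (module +-*-Solver)
open import Data.Rational.Unnormalised as ℚᵘ using (mkℚᵘ; *≡*)
import Data.Rational.Unnormalised.Properties as ℚᵘₚ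
open import Data.Fin using (Fin; toℕ)
open import Data.Fin.Properties using (toℕ-fromℕ<; toℕ-injective; toℕ<n)
open import Data.Bool using (Bool; true; false; not; if_then_else_; T)
open import Data.Unit using (tt)
open import Data.Empty using (⊥; ⊥-elim)
open import Data.Product using (∃; _×_; _,_; proj₁; proj₂)
open import Data.Sum as Sum using (_⊎_; inj₁; inj₂)
open import Data.Sum.Properties using (inj₁-injective)
open import Data.List using (List; []; _∷_; map; _++_; length)
open import Data.List.Relation.Unary.All using (All; []; _∷_)
open import Data.Vec using (Vec; []; _∷_)
open import Data.Vec.Relation.Unary.All as VecAll using ([]; _∷_)
open import Function using (_∘_)
open import Relation.Nullary using (yes; no)
open import Relation.Binary.PropositionalEquality

-- Finite sums over intervals and cycles

∑ : ℕ → (ℕ → ℕ) → ℕ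
∑ zero    f = 0
∑ (suc n) f = ∑ n f + f n

∑-cong : ∀ n {f g : ℕ → ℕ} → (∀ i → i < n → f i ≡ g i) → ∑ n f ≡ ∑ n g
∑-cong zero    eq = refl
∑-cong (suc n) eq = cong₂ _+_ (∑-cong n (λ i i<n → eq i (m<n⇒m<1+n i<n))) (eq n ≤-refl)

∑-mono : ∀ n {f g : ℕ → ℕ} → (∀ i → i < n → f i ≤ g i) → ∑ n f ≤ ∑ n g
∑-mono zero    le = z≤n
∑-mono (suc n) le = +-mono-≤ (∑-mono n (λ i i<n → le i (m<n⇒m<1+n i<n))) (le n ≤-refl)

∑-+ : ∀ n (f g : ℕ → ℕ) → ∑ n (λ i → f i + g i) ≡ ∑ n f + ∑ n g
∑-+ zero    f g = refl
∑-+ (suc n) f g = trans (cong (_+ (f n + g n)) (∑-+ n f g)) (swap (∑ n f) (∑ n g) (f n) (g n))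
  where
  swap : ∀ a b c d → a + b + (c + d) ≡ a + c + (b + d)
  swap = solve-∀

∑-* : ∀ n Q {f g : ℕ → ℕ} → (∀ i → g i ≡ Q * f i) → ∑ n g ≡ Q * ∑ n f
∑-* zero    Q eq = sym (*-zeroʳ Q)
∑-* (suc n) Q eq = trans (cong₂ _+_ (∑-* n Q eq) (eq n)) (sym (*-distribˡ-+ Q _ _))

∑-const : ∀ n k → ∑ n (λ _ → k) ≡ n * k
∑-const zero    k = refl
∑-const (suc n) k = trans (cong (_+ k) (∑-const n k)) (+-comm (n * k) k)

∑-head : ∀ n (f : ℕ → ℕ) → ∑ (suc n) f ≡ f 0 + ∑ n (f ∘ suc)
∑-head zero    f = sym (+-identityʳ (f 0))
∑-head (suc n) f = trans (cong (_+ f (suc n)) (∑-head n f)) (+-assoc (f 0) _ _)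

∑-≤-length : ∀ {a b} (f : ℕ → ℕ) → a ≤ b → ∑ a f ≤ ∑ b f
∑-≤-length {a} {zero} f z≤n = z≤n
∑-≤-length {a} {suc b} f a≤ with m≤n⇒m<n∨m≡n a≤
... | inj₁ a<  = ≤-trans (∑-≤-length f (≤-pred a<)) (m≤m+n _ _)
... | inj₂ refl = ≤-refl

∑-stable : ∀ m N {f : ℕ → ℕ} → (∀ o → m ≤ o → f o ≡ 0) → m ≤ N → ∑ N f ≡ ∑ m f
∑-stable m N zeros m≤N with m≤n⇒m<n∨m≡n m≤N
... | inj₂ refl = refl
∑-stable m (suc N) zeros m≤N | inj₁ m<N =
  trans (cong₂ _+_ (∑-stable m N zeros (≤-pred m<N)) (zeros N (≤-pred m<N))) (+-identityʳ _)

∑-swap : ∀ m n (f : ℕ → ℕ → ℕ) → ∑ m (λ i → ∑ n (f i)) ≡ ∑ n (λ l → ∑ m (λ i → f i l))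
∑-swap m zero    f = trans (∑-const m 0) (*-zeroʳ m)
∑-swap m (suc n) f = trans (∑-+ m _ _) (cong (_+ ∑ m (λ i → f i n)) (∑-swap m n f))

-- Under termwise domination no loss at one index can be made up at another. `descend` uses this to
-- pass from equal totals to a pointwise fixed point.
∑-tight : ∀ n {f g : ℕ → ℕ} → (∀ i → f i ≤ g i) → ∑ n g ≤ ∑ n f → ∀ i → i < n → g i ≤ f i
∑-tight (suc n) {f} {g} f≤g tight i i<1+n with m≤n⇒m<n∨m≡n (≤-pred i<1+n)
... | inj₁ i<n = ∑-tight n f≤g
      (+-cancelʳ-≤ (f n) _ _ (≤-trans (+-monoʳ-≤ (∑ n g) (f≤g n)) tight)) i i<n
... | inj₂ refl = +-cancelˡ-≤ (∑ n f) _ _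
      (≤-trans (+-monoˡ-≤ (g n) (∑-mono n (λ i _ → f≤g i))) tight)

∑-at-most-one : ∀ n (f : ℕ → ℕ) → (∀ i → i < n → f i ≤ 1) →
                (∀ i j → i < j → j < n → f i + f j ≤ 1) → ∑ n f ≤ 1
∑-at-most-one zero    f one excl = z≤n
∑-at-most-one (suc n) f one excl with f n in eq
... | zero  = subst (_≤ 1) (sym (+-identityʳ _))
      (∑-at-most-one n f (λ i i<n → one i (m<n⇒m<1+n i<n))
                         (λ i j i<j j<n → excl i j i<j (m<n⇒m<1+n j<n)))
... | suc q = subst (λ w → w + suc q ≤ 1) (sym others) (subst (_≤ 1) eq (one n ≤-refl))
  where
  others : ∑ n f ≡ 0
  others = n≤0⇒n≡0 (≤-trans
    (∑-mono n {g = λ _ → 0} (λ i i<n →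
      +-cancelʳ-≤ 1 _ _ (≤-trans (+-monoʳ-≤ (f i) (subst (1 ≤_) (sym eq) (s≤s z≤n))) (excl i n i<n ≤-refl))))
    (≤-reflexive (trans (∑-const n 0) (*-zeroʳ n))))

-- Rotating a window of m terms by one drops f a and gains f (a + m).
∑-rotate : ∀ m (f : ℕ → ℕ) → (∀ i → f (i + m) ≡ f i) → ∀ a → ∑ m (λ i → f (a + i)) ≡ ∑ m f
∑-rotate m f per zero    = refl
∑-rotate m f per (suc a) = +-cancelˡ-≡ (f a) _ _ (begin
  f a + ∑ m (λ i → f (suc a + i))
    ≡⟨ cong₂ _+_ (cong f (sym (+-identityʳ a))) (∑-cong m (λ i _ → cong f (sym (+-suc a i)))) ⟩
  f (a + 0) + ∑ m (λ i → f (a + suc i)) ≡⟨ ∑-head m (λ i → f (a + i)) ⟨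
  ∑ m (λ i → f (a + i)) + f (a + m)     ≡⟨ cong₂ _+_ (∑-rotate m f per a) (per a) ⟩
  ∑ m f + f a                           ≡⟨ +-comm (∑ m f) (f a) ⟩
  f a + ∑ m f ∎)
  where open ≡-Reasoning

∑-pairs : ∀ h (z : ℕ → ℕ) s → (∀ j → z j + z (suc j) ≤ s) → ∀ a → ∑ (h + h) (λ i → z (a + i)) ≤ h * s
∑-pairs zero    z s le a = z≤n
∑-pairs (suc h) z s le a rewrite +-suc h h = begin
  ∑ (h + h) f + f (h + h) + f (suc (h + h))   ≡⟨ +-assoc (∑ (h + h) f) _ _ ⟩
  ∑ (h + h) f + (f (h + h) + f (suc (h + h))) ≤⟨ +-mono-≤ (∑-pairs h z s le a)
                                                   (subst (λ w → f (h + h) + z w ≤ s) (sym (+-suc a (h + h))) (le (a + (h + h)))) ⟩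
  h * s + s                                   ≡⟨ +-comm (h * s) s ⟩
  s + h * s ∎
  where
  open ≤-Reasoning
  f : ℕ → ℕ
  f i = z (a + i)

-- The zero at `a` cuts the odd cycle open; the other `h + h` terms fall into `h` adjacent pairs of
-- sum at most `s`.
∑-odd-cycle : ∀ h (z : ℕ → ℕ) s → (∀ i → z (i + suc (h + h)) ≡ z i) → (∀ j → z j + z (suc j) ≤ s) →
              ∀ a → z a ≡ 0 → ∑ (suc (h + h)) z ≤ h * s
∑-odd-cycle h z s per pair a za≡0 = begin
  ∑ (suc (h + h)) z                              ≡⟨ ∑-rotate (suc (h + h)) z per a ⟨
  ∑ (suc (h + h)) (λ i → z (a + i))              ≡⟨ ∑-head (h + h) (λ i → z (a + i)) ⟩
  z (a + 0) + ∑ (h + h) (λ i → z (a + suc i))    ≡⟨ cong₂ _+_ (trans (cong z (+-identityʳ a)) za≡0)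
                                                      (∑-cong (h + h) (λ i _ → cong z (+-suc a i))) ⟩
  ∑ (h + h) (λ i → z (suc a + i))                ≤⟨ ∑-pairs h z s pair (suc a) ⟩
  h * s ∎
  where open ≤-Reasoning

-- Hermite's identity for floors.
∑-floors : ∀ s .{{_ : NonZero s}} a → ∑ s (λ r → (a + r) / s) ≡ a
∑-floors s zero = trans (∑-cong s (λ r r<s → m<n⇒m/n≡0 r<s)) (trans (∑-const s 0) (*-zeroʳ s))
∑-floors s (suc a) = +-cancelˡ-≡ (a / s) _ _ (begin
  a / s + ∑ s (λ r → (suc a + r) / s)
    ≡⟨ cong₂ _+_ (cong (_/ s) (sym (+-identityʳ a))) (∑-cong s (λ r _ → cong (_/ s) (sym (+-suc a r)))) ⟩
  (a + 0) / s + ∑ s (λ r → (a + suc r) / s) ≡⟨ ∑-head s (λ r → (a + r) / s) ⟨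
  ∑ s (λ r → (a + r) / s) + (a + s) / s     ≡⟨ cong₂ _+_ (∑-floors s a) (cong (_/ s) (+-comm a s)) ⟩
  a + (s + a) / s                           ≡⟨ cong (a +_) (trans (cong (_/ s) (+-comm s a)) (m+n/n≡ a)) ⟩
  a + suc (a / s)                           ≡⟨ trans (+-suc a _) (cong suc (+-comm a (a / s))) ⟩
  suc (a / s + a)                           ≡⟨ +-suc (a / s) a ⟨
  a / s + suc a ∎)
  where
  open ≡-Reasoning
  m+n/n≡ : ∀ b → (b + s) / s ≡ suc (b / s)
  m+n/n≡ b = trans (m/n≡1+[m∸n]/n (m≤n+m s b)) (cong (λ w → suc (w / s)) (m+n∸n≡m b s))

-- Splitting rim multiplicities into matchings by circular arcs

-- β r j ∈ {0, 1} tells whether colour r < s uses rim edge j.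
record RimSplit (m s : ℕ) (z : ℕ → ℕ) : Set where
  field
    β      : ℕ → ℕ → ℕ
    excl   : ∀ r j → β r j + β r (suc j) ≤ 1
    wrap   : ∀ r → β r m ≡ β r 0
    counts : ∀ j → ∑ s (λ r → β r j) ≡ z j
    empty  : ∀ r j → z j ≡ 0 → β r j ≡ 0

-- Rim edge j receives the arc [P j , P j + z j) of the colour circle ℤ/s, where consecutive starting
-- points differ by at least z j and at most s ∸ z (j+1), and P winds h times around the circle.
rim-split : ∀ m s z h → z m ≡ z 0 → (∀ j → z j + z (suc j) ≤ s) → h + h ≤ m → ∑ m z ≤ h * s → RimSplit m s z
rim-split m zero z h zm pair hm sum = record
  { β = λ _ _ → 0 ; excl = λ _ _ → z≤n ; wrap = λ _ → refl
  ; counts = λ j → sym (n≤0⇒n≡0 (≤-trans (m≤m+n _ _) (pair j)))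
  ; empty = λ _ _ _ → refl }
rim-split m s@(suc _) z h zm pair hm sum = record
  { β = β ; excl = excl ; wrap = wrap ; counts = counts ; empty = empty }
  where
  open ≤-Reasoning
  hi : ℕ → ℕ
  hi j = s ∸ z (suc j)

  z≤s : ∀ j → z j ≤ s
  z≤s j = ≤-trans (m≤m+n _ _) (pair j)

  lo≤hi : ∀ j → z j ≤ hi j
  lo≤hi j = m+n≤o⇒m≤o∸n (z j) (pair j)

  P : ℕ → ℕ
  -- Both terms bound the start from above: the first comes from taking the longest steps `hi` from
  -- 0, the second leaves room for the shortest steps `z` up to `h * s` at `m`. As `z j ≤ hi j`, the
  -- steps of the minimum stay between the two.
  P j = ∑ j hi ⊓ ((h * s ∸ ∑ m z) + ∑ j z)

  P-lower : ∀ j → P j + z j ≤ P (suc j)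
  P-lower j = ⊓-glb
    (+-mono-≤ (m⊓n≤m _ _) (lo≤hi j))
    (≤-trans (+-monoˡ-≤ (z j) (m⊓n≤n (∑ j hi) _)) (≤-reflexive (+-assoc (h * s ∸ ∑ m z) _ _)))

  P-upper : ∀ j → P (suc j) + z (suc j) ≤ P j + s
  P-upper j = begin
    P (suc j) + z (suc j)        ≤⟨ +-monoˡ-≤ (z (suc j)) (lip (∑ j hi) (h * s ∸ ∑ m z) (∑ j z)) ⟩
    P j + hi j + z (suc j)       ≡⟨ +-assoc (P j) _ _ ⟩
    P j + (hi j + z (suc j))     ≡⟨ cong (P j +_) (m∸n+n≡m (z≤s (suc j))) ⟩
    P j + s ∎
    where
    lip : ∀ a b d → (a + hi j) ⊓ (b + (d + z j)) ≤ (a ⊓ (b + d)) + hi j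
    lip a b d = ≤-trans (⊓-monoʳ-≤ (a + hi j)
        (≤-trans (≤-reflexive (sym (+-assoc b d (z j)))) (+-monoʳ-≤ (b + d) (lo≤hi j))))
      (≤-reflexive (sym (+-distribʳ-⊓ (hi j) a (b + d))))

  hi-total : ∑ m hi + ∑ m z ≡ m * s
  hi-total = begin-equality
    ∑ m hi + ∑ m z                   ≡⟨ cong (∑ m hi +_) shift ⟩
    ∑ m hi + ∑ m (z ∘ suc)           ≡⟨ ∑-+ m hi (z ∘ suc) ⟨
    ∑ m (λ j → hi j + z (suc j))     ≡⟨ ∑-cong m (λ j _ → m∸n+n≡m (z≤s (suc j))) ⟩
    ∑ m (λ _ → s)                    ≡⟨ ∑-const m s ⟩
    m * s ∎
    where
    shift : ∑ m z ≡ ∑ m (z ∘ suc)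
    shift = +-cancelˡ-≡ (z 0) _ _ (begin-equality
      z 0 + ∑ m z       ≡⟨ +-comm (z 0) _ ⟩
      ∑ m z + z 0       ≡⟨ cong (∑ m z +_) zm ⟨
      ∑ (suc m) z       ≡⟨ ∑-head m z ⟩
      z 0 + ∑ m (z ∘ suc) ∎)

  P-end : P m ≡ h * s
  -- The second term equals `h * s` at `m`. The first is no smaller, because
  -- `h * s + ∑ m z ≤ (h + h) * s ≤ m * s`.
  P-end = trans (cong (∑ m hi ⊓_) (m∸n+n≡m sum)) (m≥n⇒m⊓n≡n (+-cancelʳ-≤ (∑ m z) _ _ (begin
    h * s + ∑ m z   ≤⟨ +-monoʳ-≤ (h * s) sum ⟩
    h * s + h * s   ≡⟨ *-distribʳ-+ s h h ⟨
    (h + h) * s     ≤⟨ *-monoˡ-≤ s hm ⟩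
    m * s           ≡⟨ hi-total ⟨
    ∑ m hi + ∑ m z ∎)))

  fl : ℕ → ℕ → ℕ
  fl r a = (a + r) / s

  fl-mono : ∀ r a b → a ≤ b → fl r a ≤ fl r b
  fl-mono r a b a≤b = /-monoˡ-≤ s (+-monoˡ-≤ r a≤b)

  fl-turns : ∀ r q a → fl r (q * s + a) ≡ q + fl r a
  fl-turns r zero a = refl
  fl-turns r (suc q) a = begin-equality
    (s + q * s + a + r) / s            ≡⟨ m/n≡1+[m∸n]/n (≤-trans (m≤m+n s _) (≤-reflexive (sym assoc))) ⟩
    suc ((s + q * s + a + r ∸ s) / s)  ≡⟨ cong (λ w → suc (w / s)) (trans (cong (_∸ s) assoc) (m+n∸m≡n s _)) ⟩
    suc (fl r (q * s + a))             ≡⟨ cong suc (fl-turns r q a) ⟩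
    suc (q + fl r a) ∎
    where
    assoc : s + q * s + a + r ≡ s + (q * s + a + r)
    assoc = trans (cong (_+ r) (+-assoc s (q * s) a)) (+-assoc s _ r)

  -- Colour `r` sits at the points congruent to -1 - r modulo `s`, and the difference of floors
  -- counts those in the arc from `P j` up to, but excluding, `P j + z j`.
  β : ℕ → ℕ → ℕ
  β r j = fl r (P j + z j) ∸ fl r (P j)

  -- The arcs of rim edges `j` and `j + 1` follow one another within a single turn starting at
  -- `P j`, and each colour occurs once per turn.
  excl : ∀ r j → β r j + β r (suc j) ≤ 1
  excl r j = begin
    β r j + β r (suc j)                        ≡⟨ +-comm (β r j) _ ⟩
    (p₄ ∸ p₃) + (p₂ ∸ p₁)                      ≤⟨ +-monoʳ-≤ (p₄ ∸ p₃) (∸-monoˡ-≤ p₁ (fl-mono r (P j + z j) (P (suc j)) (P-lower j))) ⟩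
    (p₄ ∸ p₃) + (p₃ ∸ p₁)                      ≡⟨ +-∸-assoc (p₄ ∸ p₃) p₁≤p₃ ⟨
    (p₄ ∸ p₃) + p₃ ∸ p₁                        ≡⟨ cong (_∸ p₁) (m∸n+n≡m (fl-mono r (P (suc j)) _ (m≤m+n _ (z (suc j))))) ⟩
    p₄ ∸ p₁                                    ≤⟨ ∸-monoˡ-≤ p₁ (fl-mono r (P (suc j) + z (suc j)) (P j + s) (P-upper j)) ⟩
    fl r (P j + s) ∸ p₁                        ≡⟨ cong (_∸ p₁) (trans (cong (fl r) (trans (+-comm (P j) s)
                                                   (cong (_+ P j) (sym (*-identityˡ s))))) (fl-turns r 1 (P j))) ⟩
    suc p₁ ∸ p₁                                ≡⟨ m+n∸n≡m 1 p₁ ⟩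
    1 ∎
    where
    p₁ p₂ p₃ p₄ : ℕ
    p₁ = fl r (P j)
    p₂ = fl r (P j + z j)
    p₃ = fl r (P (suc j))
    p₄ = fl r (P (suc j) + z (suc j))
    p₁≤p₃ : p₁ ≤ p₃
    p₁≤p₃ = fl-mono r (P j) (P (suc j)) (≤-trans (m≤m+n _ (z j)) (P-lower j))

  wrap : ∀ r → β r m ≡ β r 0
  wrap r = begin-equality
    fl r (P m + z m) ∸ fl r (P m)            ≡⟨ cong₂ (λ p y → fl r (p + y) ∸ fl r p) P-end zm ⟩
    fl r (h * s + z 0) ∸ fl r (h * s)        ≡⟨ cong₂ _∸_ (fl-turns r h (z 0))
                                                  (trans (cong (fl r) (sym (+-identityʳ (h * s)))) (fl-turns r h 0)) ⟩
    (h + fl r (z 0)) ∸ (h + fl r 0)          ≡⟨ [m+n]∸[m+o]≡n∸o h _ _ ⟩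
    fl r (z 0) ∸ fl r 0 ∎

  counts : ∀ j → ∑ s (λ r → β r j) ≡ z j
  counts j = +-cancelʳ-≡ (P j) _ _ (begin-equality
    ∑ s (λ r → β r j) + P j                      ≡⟨ cong (∑ s (λ r → β r j) +_) (∑-floors s (P j)) ⟨
    ∑ s (λ r → β r j) + ∑ s (λ r → fl r (P j))   ≡⟨ ∑-+ s _ _ ⟨
    ∑ s (λ r → β r j + fl r (P j))               ≡⟨ ∑-cong s (λ r _ → m∸n+n≡m (fl-mono r (P j) _ (m≤m+n _ (z j)))) ⟩
    ∑ s (λ r → fl r (P j + z j))                 ≡⟨ ∑-floors s (P j + z j) ⟩
    P j + z j                                    ≡⟨ +-comm (P j) _ ⟩
    z j + P j ∎)

  empty : ∀ r j → z j ≡ 0 → β r j ≡ 0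
  empty r j z≡0 = trans (cong (λ w → fl r w ∸ fl r (P j)) (trans (cong (P j +_) z≡0) (+-identityʳ (P j)))) (n∸n≡0 (fl r (P j)))

-- The greedy recursion along the rim

even? : ℕ → Bool
even? 0 = true
even? 1 = false
even? (suc (suc o)) = even? o

even?-suc : ∀ o → even? (suc o) ≡ not (even? o)
even?-suc 0 = refl
even?-suc 1 = refl
even?-suc (suc (suc o)) = even?-suc o

even?-double : ∀ h → even? (h + h) ≡ true
even?-double zero = refl
even?-double (suc h) rewrite +-suc h h = even?-double h

-- Prefix counts grow along even offsets and shrink along odd ones, so the parity decides on which
-- side the difference `d` is added.
Gap : Bool → ℕ → ℕ → ℕ → Set
Gap true  a b d = a + d ≡ b
Gap false a b d = b + d ≡ a

gap-dist : ∀ p {a b d} → Gap p a b d → ∣ a - b ∣ ≡ d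
gap-dist true  {a} refl = ∣m-m+n∣≡n a _
gap-dist false {b = b} refl = trans (∣-∣-comm _ b) (∣m-m+n∣≡n b _)

gap-zero : ∀ p {a b} → Gap p a b 0 → a ≡ b
gap-zero true  eq = trans (sym (+-identityʳ _)) eq
gap-zero false eq = trans (sym eq) (+-identityʳ _)

-- Truncation at 0 and capping at `c` are monotone and never enlarge a difference, so the excess `d`
-- of u' - v' over u - v survives with the same sign and at most the same size.
clip : ∀ c u v u' v' d → u' + v ≡ u + v' + d → ∃ λ d' → d' ≤ d × (c ⊓ (u ∸ v)) + d' ≡ c ⊓ (u' ∸ v')
clip c u v u' v' d eq = y ∸ x , m≤n+o⇒m∸n≤o y x y≤x+d , m+[n∸m]≡n x≤y
  where
  open ≤-Reasoning
  x y : ℕ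
  x = c ⊓ (u ∸ v)
  y = c ⊓ (u' ∸ v')
  perm : ∀ a b e f → a + b + e + f ≡ e + (b + f) + a
  perm = solve-∀
  x≤y : x ≤ y
  x≤y = ⊓-monoʳ-≤ c (m≤n+o⇒m∸n≤o u v (+-cancelʳ-≤ v' _ _ (begin
    u + v'                  ≤⟨ m≤m+n _ d ⟩
    u + v' + d              ≡⟨ eq ⟨
    u' + v                  ≤⟨ +-monoˡ-≤ v (m≤n+m∸n u' v') ⟩
    v' + (u' ∸ v') + v      ≡⟨ trans (+-comm _ v) (trans (cong (v +_) (+-comm v' _)) (sym (+-assoc v _ v'))) ⟩
    v + (u' ∸ v') + v' ∎)))
  y≤x+d : y ≤ x + d
  y≤x+d = ≤-trans (⊓-mono-≤ (m≤m+n c d) (m≤n+o⇒m∸n≤o u' v' (+-cancelʳ-≤ v _ _ (begin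
    u' + v                  ≡⟨ eq ⟩
    u + v' + d              ≤⟨ +-monoˡ-≤ d (+-monoˡ-≤ v' (m≤n+m∸n u v)) ⟩
    v + (u ∸ v) + v' + d    ≡⟨ perm v (u ∸ v) v' d ⟩
    v' + (u ∸ v + d) + v ∎))))
    (≤-reflexive (sym (+-distribʳ-⊓ d c (u ∸ v))))

Periodic : ℕ → (ℕ → ℕ) → Set
Periodic m f = ∀ i → f (i + m) ≡ f i

periodic-* : ∀ {m f} → Periodic m f → ∀ q i → f (i + q * m) ≡ f i
periodic-* {m} {f} per zero    i = cong f (+-identityʳ i)
periodic-* {m} {f} per (suc q) i = trans (cong f (perm i m (q * m))) (trans (per (i + q * m)) (periodic-* per q i))
  where
  perm : ∀ a b e → a + (b + e) ≡ a + e + b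
  perm = solve-∀

periodic-% : ∀ {m f} .{{_ : NonZero m}} → Periodic m f → ∀ i → f (i % m) ≡ f i
periodic-% {m} {f} per i = trans (sym (periodic-* per (i / m) (i % m))) (cong f (sym (m≡m%n+[m/n]*n i m)))

-- Spoke demands by offset from a rim edge

module Ahead (m : ℕ) (s : ℕ → ℕ) where

  -- The cut-off at `m` lets every spoke occur at one offset only. Offsets 0 and 1 belong to the two
  -- spokes that meet rim edge `j`.
  ahead : ℕ → ℕ → ℕ
  ahead j o with o <? m
  ... | yes _ = s (j + o)
  ... | no  _ = 0

  -- sums ahead j over the offsets 2, 4, …, o or 3, 5, …, o
  S : ℕ → ℕ → ℕ
  S j 0 = 0
  S j 1 = 0
  S j (suc (suc o)) = S j o + ahead j (2 + o)

  ahead-< : ∀ j {o} → o < m → ahead j o ≡ s (j + o)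
  ahead-< j {o} o<m with o <? m
  ... | yes _  = refl
  ... | no o≮m = ⊥-elim (o≮m o<m)

  ahead-≥ : ∀ j {o} → m ≤ o → ahead j o ≡ 0
  ahead-≥ j {o} m≤o with o <? m
  ... | yes o<m = ⊥-elim (<⇒≱ o<m m≤o)
  ... | no _    = refl

  -- Both sides refer to the spoke `j + 1 + o`. They can differ only at `suc o ≡ m`, where the
  -- left-hand side is already cut off.
  ahead-step : ∀ j o → ahead j (suc o) ≤ ahead (suc j) o
  ahead-step j o with suc o <? m | o <? m
  ... | no _     | _ = z≤n
  ... | yes o+<m | no o≮m = ⊥-elim (o≮m (<-trans (n<1+n o) o+<m))
  ... | yes _    | yes _ = ≤-reflexive (cong s (+-suc j o))

  S-sum : ∀ j N → ∑ (2 + N) (ahead j) ≡ ahead j 0 + ahead j 1 + (S j N + S j (suc N))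
  S-sum j zero    = sym (+-identityʳ _)
  S-sum j (suc N) = begin
    ∑ (2 + N) (ahead j) + ahead j (2 + N)       ≡⟨ cong (_+ ahead j (2 + N)) (S-sum j N) ⟩
    e + (S j N + S j (suc N)) + ahead j (2 + N) ≡⟨ perm e (S j N) (S j (suc N)) _ ⟩
    e + (S j (suc N) + (S j N + ahead j (2 + N))) ∎
    where
    open ≡-Reasoning
    e : ℕ
    e = ahead j 0 + ahead j 1
    perm : ∀ a b d f → a + (b + d) + f ≡ a + (d + (b + f))
    perm = solve-∀

  module _ (per : Periodic m s) where

    ahead-periodic : ∀ j o → ahead (j + m) o ≡ ahead j o
    ahead-periodic j o with o <? m
    ... | yes _ = trans (cong s (trans (+-assoc j m o) (trans (cong (j +_) (+-comm m o)) (sym (+-assoc j o m))))) (per (j + o))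
    ... | no  _ = refl

    S-periodic : ∀ j o → S (j + m) o ≡ S j o
    S-periodic j 0 = refl
    S-periodic j 1 = refl
    S-periodic j (suc (suc o)) = cong₂ _+_ (S-periodic j o) (ahead-periodic j (2 + o))

    ahead-total : ∀ j N → m ≤ N → ∑ N (ahead j) ≡ ∑ m s
    ahead-total j N m≤N = trans (∑-stable m N (λ o → ahead-≥ j) m≤N)
      (trans (∑-cong m (λ o o<m → ahead-< j o<m)) (∑-rotate m s per j))

    S-total : ∀ j N → 2 ≤ m → m ≤ 2 + N → s j + s (suc j) + (S j N + S j (suc N)) ≡ ∑ m s
    S-total j N 2≤m m≤N = trans
      (cong (_+ (S j N + S j (suc N))) (sym (cong₂ _+_
        (trans (ahead-< j (≤-trans (s≤s z≤n) 2≤m)) (cong s (+-identityʳ j)))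
        (trans (ahead-< j 2≤m) (cong s (+-comm j 1))))))
      (trans (sym (S-sum j N)) (ahead-total j (2 + N) m≤N))

  S-double : ∀ j h → h + h < m → S j (h + h) ≡ ∑ h (λ l → s (j + (2 + (l + l))))
  S-double j zero    lt = refl
  S-double j (suc h) lt rewrite +-suc h h = cong₂ _+_ (S-double j h (<-trans (m<n⇒m<1+n (n<1+n _)) lt)) (ahead-< j lt)

module Update (m t : ℕ) (c s : ℕ → ℕ) where
  open Ahead m s

  -- If `u` holds the prefix counts at rim edge `j`, then `(up j o + u (suc o)) ∸ dn j o` is the
  -- number of free colours in a prefix at `j + 1`. For even `o` the prefix has `S (suc j) o`
  -- colours. For odd `o` it has all `t` colours except those of the spokes `j + 1` and `j + 2` and
  -- of the offsets 3, 5, ..., `o`. In both cases `c j ∸ u (suc o)` of them are taken at `j`.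
  up dn : ℕ → ℕ → ℕ
  up j o = if even? o then S (suc j) o else t
  dn j o = if even? o then c j else c j + (s (suc j) + s (2 + j)) + S (suc j) o

-- The demands c (rim) and s (spokes) have a fractional decomposition of weight t with denominator Q. In it,
-- Y j o / Q is the weight of the matchings through rim edge j whose spoke is among the offsets 2, 4, …, o from j
-- (o even), or is absent or not among the offsets 3, 5, …, o (o odd).
record Fractional (m t h Q : ℕ) (c s : ℕ → ℕ) : Set where
  open Update m t c s
  field
    Y          : ℕ → ℕ → ℕ
    c-periodic : Periodic m c
    s-periodic : Periodic m s
    Y-periodic : ∀ j o → Y (j + m) o ≡ Y j o
    Y-cap      : ∀ j o → Y j o ≤ Q * c j
    Y-full     : ∀ j → Y j 1 ≡ Q * c j
    Y-step     : ∀ j o → Y (suc j) o + Q * dn j o ≤ Q * up j o + Y j (suc o)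
    s-total    : ∑ m s ≤ t
    c-total    : ∑ m c ≤ h * t

-- x k j counts the matchings with spoke k through rim edge j, and x∞ j those without a spoke.
record Layers (m t h : ℕ) .{{_ : NonZero m}} (c s : ℕ → ℕ) : Set where
  field
    x          : ℕ → ℕ → ℕ
    x∞         : ℕ → ℕ
    x-periodic : ∀ k → Periodic m (x k)
    x∞-periodic : Periodic m x∞
    x-pair     : ∀ k j → x k j + x k (suc j) ≤ s k
    x∞-pair    : ∀ j → x∞ j + x∞ (suc j) ≤ t ∸ ∑ m s
    x-after    : ∀ k → x k k ≡ 0
    x-before   : ∀ k j → k ≡ suc j % m → x k j ≡ 0
    x-total    : ∀ j → ∑ m (λ k → x k j) + x∞ j ≡ c j
    x-sum      : ∀ k → ∑ m (x k) ≤ h * s k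
    x∞-sum     : ∑ m x∞ ≤ h * (t ∸ ∑ m s)

-- The periodic greedy solution

module Solve (n t h Q : ℕ) (c s : ℕ → ℕ) (Q>0 : 0 < Q)
             (hm : h + h ≤ 2 + n) (mh : 2 + n ≤ suc (h + h))
             (F : Fractional (2 + n) t h Q c s) where

  private
    m : ℕ
    m = 2 + n

  open Ahead m s
  open Fractional F
  open Update m t c s

  -- From the integral counterpart u of Y j / Q, the one at rim edge j + 1 when as many colours as possible are taken
  -- from the front of the order 2, 4, 6, …, ∞, …, 5, 3 of offsets from j + 1. The offsets from j + 1 are one less
  -- than those from j, so the orders at j and at j + 1 are reverse to each other.
  Φ : ℕ → (ℕ → ℕ) → ℕ → ℕ
  Φ j u o = c (suc j) ⊓ ((up j o + u (suc o)) ∸ dn j o)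

  run : (ℕ → ℕ) → ℕ → ℕ → ℕ
  run u zero    = u
  run u (suc j) = Φ j (run u j)

  Φ-mono : ∀ j {u v : ℕ → ℕ} → (∀ o → u o ≤ v o) → ∀ o → Φ j u o ≤ Φ j v o
  Φ-mono j u≤v o = ⊓-monoʳ-≤ (c (suc j)) (∸-monoˡ-≤ (dn j o) (+-monoʳ-≤ (up j o) (u≤v (suc o))))

  run-mono : ∀ j {u v : ℕ → ℕ} → (∀ o → u o ≤ v o) → ∀ o → run u j o ≤ run v j o
  run-mono zero    u≤v = u≤v
  run-mono (suc j) u≤v = Φ-mono j (run-mono j u≤v)

  Φ-cong : ∀ j {u v : ℕ → ℕ} → (∀ o → u o ≡ v o) → ∀ o → Φ j u o ≡ Φ j v o
  Φ-cong j u≡v o = cong (λ w → c (suc j) ⊓ ((up j o + w) ∸ dn j o)) (u≡v (suc o))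

  up-periodic : ∀ j o → up (j + m) o ≡ up j o
  up-periodic j o with even? o
  ... | true  = S-periodic s-periodic (suc j) o
  ... | false = refl

  dn-periodic : ∀ j o → dn (j + m) o ≡ dn j o
  dn-periodic j o with even? o
  ... | true  = c-periodic j
  ... | false = cong₂ _+_ (cong₂ _+_ (c-periodic j) (cong₂ _+_ (s-periodic (suc j)) (s-periodic (2 + j))))
                          (S-periodic s-periodic (suc j) o)

  Φ-periodic : ∀ j u o → Φ (j + m) u o ≡ Φ j u o
  Φ-periodic j u o = cong₂ _⊓_ (c-periodic (suc j))
    (cong₂ _∸_ (cong (_+ u (suc o)) (up-periodic j o)) (dn-periodic j o))

  run-periodic : ∀ u → (∀ o → run u m o ≡ u o) → ∀ j o → run u (j + m) o ≡ run u j o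
  run-periodic u fix zero    = fix
  run-periodic u fix (suc j) o = trans (Φ-periodic j (run u (j + m)) o) (Φ-cong j (run-periodic u fix j) o)

  -- `gap` and `mid` bound the share of each spoke class and of class ∞ by the size of the class,
  -- and `dom` keeps the state above the fractional solution. Since `m ≤ suc (h + h)`, the prefixes
  -- `h + h` and `suc (h + h)` lie past all even and all odd offsets, so they differ by class ∞
  -- alone.
  record Inv (j : ℕ) (u : ℕ → ℕ) : Set where
    field
      cap : ∀ o → u o ≤ c j
      gap : ∀ o → ∃ λ d → d ≤ ahead j (2 + o) × Gap (even? o) (u o) (u (2 + o)) d
      dom : ∀ o → Y j o ≤ Q * u o
      mid : ∃ λ d → d ≤ t ∸ ∑ m s × u (h + h) + d ≡ u (suc (h + h))

  open Inv

  -- Here x is the use of the spoke class at rim edge j. Keeping it in the bound for rim edge j + 1 gives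
  -- the constraint between consecutive rim edges, which the field gap alone forgets.
  gap-step : ∀ j u o x → x ≤ ahead (suc j) (2 + o) → Gap (even? (suc o)) (u (suc o)) (u (3 + o)) x →
             ∃ λ d → d ≤ ahead (suc j) (2 + o) ∸ x × Gap (even? o) (Φ j u o) (Φ j u (2 + o)) d
  gap-step j u o x x≤ g rewrite even?-suc o with even? o
  ... | true  = clip (c (suc j)) _ (c j) _ (c j) _ (trans (cong (λ w → A + w + u (3 + o) + c j) (sym (m+[n∸m]≡n x≤)))
        (trans (perm A x (σ ∸ x) (u (3 + o)) (c j)) (cong (λ w → A + w + c j + (σ ∸ x)) g)))
    where
    σ A : ℕ
    σ = ahead (suc j) (2 + o)
    A = S (suc j) o
    perm : ∀ a x y e f → a + (x + y) + e + f ≡ a + (e + x) + f + y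
    perm = solve-∀
  ... | false = clip (c (suc j)) _ (B + (A + σ)) _ (B + A) _
        (trans (cong (λ w → t + u (suc o) + (B + (A + w))) (sym (m+[n∸m]≡n x≤)))
        (trans (perm t (u (suc o)) B A x (σ ∸ x)) (cong (λ w → t + w + (B + A) + (σ ∸ x)) g)))
    where
    σ A B : ℕ
    σ = ahead (suc j) (2 + o)
    A = S (suc j) o
    B = c j + (s (suc j) + s (2 + j))
    perm : ∀ t e b a x y → t + e + (b + (a + (x + y))) ≡ t + (e + x) + (b + a) + y
    perm = solve-∀

  mid-step : ∀ j u x → u (h + h) ≡ u (2 + (h + h)) → x ≤ t ∸ ∑ m s → u (h + h) + x ≡ u (suc (h + h)) →
             ∃ λ d → d ≤ (t ∸ ∑ m s) ∸ x × Φ j u (h + h) + d ≡ Φ j u (suc (h + h))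
  mid-step j u x stable x≤ eq rewrite even?-suc (h + h) | even?-double h | sym stable | sym eq =
    clip (c (suc j)) _ (c j) _ _ _ (begin
      t + f + c j                             ≡⟨ cong (λ w → w + f + c j) t-split ⟩
      ∑ m s + (x + (z ∸ x)) + f + c j         ≡⟨ cong (λ w → w + (x + (z ∸ x)) + f + c j)
                                                   (sym (S-total s-periodic (suc j) (h + h) (s≤s (s≤s z≤n)) (≤-trans mh (n≤1+n _)))) ⟩
      ss + (A + B) + (x + (z ∸ x)) + f + c j  ≡⟨ perm ss A B x (z ∸ x) f (c j) ⟩
      A + (f + x) + (c j + ss + B) + (z ∸ x) ∎)
    where
    open ≡-Reasoning
    f z ss A B : ℕ
    f = u (h + h)
    z = t ∸ ∑ m s
    ss = s (suc j) + s (2 + j)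
    A = S (suc j) (h + h)
    B = S (suc j) (suc (h + h))
    t-split : t ≡ ∑ m s + (x + (z ∸ x))
    t-split = trans (sym (m+[n∸m]≡n s-total)) (cong (∑ m s +_) (sym (m+[n∸m]≡n x≤)))
    perm : ∀ p a b x y f c → p + (a + b) + (x + y) + f + c ≡ a + (f + x) + (c + p + b) + y
    perm = solve-∀

  stable : ∀ {j u} → Inv j u → ∀ o → m ≤ 2 + o → u o ≡ u (2 + o)
  stable {j} I o m≤ with gap I o
  ... | d , d≤ , g rewrite ahead-≥ j m≤ | n≤0⇒n≡0 d≤ = gap-zero (even? o) g

  Inv-step : ∀ {j u} → Inv j u → Inv (suc j) (Φ j u)
  Inv-step {j} {u} I = record
    { cap = λ o → m⊓n≤m (c (suc j)) _
    ; gap = λ o → let (x , x≤ , g) = gap I (suc o)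
                      (d , d≤ , g′) = gap-step j u o x (≤-trans x≤ (ahead-step j (2 + o))) g
                  in d , ≤-trans d≤ (m∸n≤m _ x) , g′
    ; dom = λ o → ≤-trans (⊓-glb (Y-cap (suc j) o) (rest o)) (≤-reflexive (sym (*-distribˡ-⊓ Q _ _)))
    ; mid = let (x , x≤ , eq) = mid I
                (d , d≤ , eq′) = mid-step j u x (stable I (h + h) (≤-trans mh (n≤1+n _))) x≤ eq
            in d , ≤-trans d≤ (m∸n≤m _ x) , eq′
    }
    where
    open ≤-Reasoning
    rest : ∀ o → Y (suc j) o ≤ Q * ((up j o + u (suc o)) ∸ dn j o)
    rest o = begin
      Y (suc j) o                                ≤⟨ m+n≤o⇒m≤o∸n (Y (suc j) o) (Y-step j o) ⟩
      Q * up j o + Y j (suc o) ∸ Q * dn j o      ≤⟨ ∸-monoˡ-≤ (Q * dn j o) (+-monoʳ-≤ (Q * up j o) (dom I (suc o))) ⟩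
      Q * up j o + Q * u (suc o) ∸ Q * dn j o    ≡⟨ cong (_∸ Q * dn j o) (*-distribˡ-+ Q _ _) ⟨
      Q * (up j o + u (suc o)) ∸ Q * dn j o      ≡⟨ *-distribˡ-∸ Q _ _ ⟨
      Q * ((up j o + u (suc o)) ∸ dn j o) ∎

  Inv-run : ∀ {u} → Inv 0 u → ∀ j → Inv j (run u j)
  Inv-run I zero    = I
  Inv-run I (suc j) = Inv-step (Inv-run I j)

  Inv-rewind : ∀ {u} → Inv m u → Inv 0 u
  Inv-rewind {u} I = record
    { cap = λ o → subst (u o ≤_) (c-periodic 0) (cap I o)
    ; gap = λ o → let (d , d≤ , g) = gap I o in d , subst (d ≤_) (ahead-periodic s-periodic 0 (2 + o)) d≤ , g
    ; dom = λ o → subst (_≤ Q * u o) (Y-periodic 0 o) (dom I o)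
    ; mid = mid I
    }

  top : ℕ → ℕ
  top _ = c 0

  Inv-top : Inv 0 top
  Inv-top = record
    { cap = λ _ → ≤-refl
    ; gap = λ o → 0 , z≤n , flat (even? o)
    ; dom = Y-cap 0
    ; mid = 0 , z≤n , +-identityʳ _
    }
    where
    flat : ∀ p → Gap p (c 0) (c 0) 0
    flat true  = +-identityʳ _
    flat false = +-identityʳ _

  Fixed : Set
  Fixed = ∃ λ u → Inv 0 u × (∀ o → run u m o ≡ u o)

  -- A round is monotone, so once a state has moved down all later ones do too. Each strict drop
  -- lowers `∑ m u`, which is bounded by the fuel.
  descend : ∀ fuel u → ∑ m u ≤ fuel → Inv 0 u → (∀ o → run u m o ≤ u o) → Fixed
  descend fuel u fuel≥ I dec with m≤n⇒m<n∨m≡n (∑-mono m (λ o _ → dec o))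
  descend zero    u fuel≥ I dec | inj₁ lt = ⊥-elim (n≮0 (<-≤-trans lt fuel≥))
  descend (suc fuel) u fuel≥ I dec | inj₁ lt =
    descend fuel (run u m) (≤-pred (<-≤-trans lt fuel≥)) (Inv-rewind (Inv-run I m)) (run-mono m dec)
  descend fuel u fuel≥ I dec | inj₂ eq = u , I , all
    where
    near : ∀ o → o < m → run u m o ≡ u o
    near o o<m = ≤-antisym (dec o) (∑-tight m dec (≤-reflexive (sym eq)) o o<m)
    all : ∀ o → run u m o ≡ u o
    all o with o <? m
    ... | yes o<m = near o o<m
    all 0 | no o≮m = near 0 (s≤s z≤n)
    all 1 | no o≮m = near 1 (s≤s (s≤s z≤n))
    -- No spoke has an offset from `m` on, so both states repeat what they had two offsets earlier
    -- and agreement below `m` spreads upwards.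
    all (suc (suc o)) | no o≮m = trans (sym (stable (Inv-run I m) o (≮⇒≥ o≮m)))
      (trans (all o) (stable I o (≮⇒≥ o≮m)))

  fixed : Fixed
  fixed = descend (∑ m top) top ≤-refl Inv-top
    (λ o → subst (run top m o ≤_) (c-periodic 0) (cap (Inv-run Inv-top m) o))

  -- Reading off the layers

  module Extract (u₀ : ℕ → ℕ) (I₀ : Inv 0 u₀) (fix : ∀ o → run u₀ m o ≡ u₀ o) where

    D : ℕ → ℕ → ℕ
    D = run u₀

    D-inv : ∀ j → Inv j (D j)
    D-inv = Inv-run I₀

    D-periodic : ∀ j o → D (j + m) o ≡ D j o
    D-periodic = run-periodic u₀ fix

    -- The prefix 1 comprises every class allowed at `j`. The fractional solution meets the full
    -- demand there, and `D` dominates it, so the greedy choice never runs short.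
    D-one : ∀ j → D j 1 ≡ c j
    D-one j = ≤-antisym (cap (D-inv j) 1)
      (*-cancelˡ-≤ Q {{>-nonZero Q>0}} (≤-trans (≤-reflexive (sym (Y-full j))) (dom (D-inv j) 1)))

    D-zero : ∀ j → D j 0 ≡ 0
    -- `u₀` is not by definition a value of `Φ`, so index 0 is read off one round later.
    D-zero zero    = trans (sym (D-periodic 0 0)) (D-zero m)
    D-zero (suc j) = trans (cong (c (suc j) ⊓_) (trans (cong (_∸ c j) (D-one j)) (n∸n≡0 (c j)))) (⊓-zeroʳ (c (suc j)))

    -- Prefixes two offsets apart differ by one class, upwards or downwards according to parity; the
    -- absolute difference covers both. The spokes at offsets 0 and 1 are blocked.
    X : ℕ → ℕ → ℕ
    X j 0 = 0
    X j 1 = 0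
    X j (suc (suc o)) = ∣ D j o - D j (2 + o) ∣

    X∞ : ℕ → ℕ
    X∞ j = ∣ D j (h + h) - D j (suc (h + h)) ∣

    X-gap : ∀ j o → Gap (even? o) (D j o) (D j (2 + o)) (X j (2 + o))
    X-gap j o with gap (D-inv j) o
    ... | d , _ , g = subst (Gap (even? o) (D j o) (D j (2 + o))) (sym (gap-dist (even? o) g)) g

    X-ahead : ∀ j o → X j o ≤ ahead j o
    X-ahead j 0 = z≤n
    X-ahead j 1 = z≤n
    X-ahead j (suc (suc o)) with gap (D-inv j) o
    ... | d , d≤ , g = subst (_≤ ahead j (2 + o)) (sym (gap-dist (even? o) g)) d≤

    ∸-room : ∀ {a b d} → b ≤ d → a ≤ d ∸ b → a + b ≤ d
    ∸-room {a} {b} b≤d a≤ = ≤-trans (+-monoˡ-≤ b a≤) (≤-reflexive (m∸n+n≡m b≤d))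

    -- Offset `o` from `j + 1` and offset `suc o` from `j` are the same spoke, and `gap-step` grants
    -- rim edge `j + 1` only what rim edge `j` has left of that class.
    X-cross : ∀ j o → X (suc j) o + X j (suc o) ≤ ahead (suc j) o
    X-cross j 0 = z≤n
    X-cross j 1 = ≤-trans (X-ahead j 2) (ahead-step j 1)
    X-cross j (suc (suc o))
      with gap-step j (D j) o (X j (3 + o)) (≤-trans (X-ahead j (3 + o)) (ahead-step j (2 + o))) (X-gap j (suc o))
    ... | d , d≤ , g rewrite gap-dist (even? o) g =
      ∸-room (≤-trans (X-ahead j (3 + o)) (ahead-step j (2 + o))) d≤

    X∞-gap : ∀ j → D j (h + h) + X∞ j ≡ D j (suc (h + h))
    X∞-gap j with mid (D-inv j)
    ... | d , _ , eq = subst (λ w → D j (h + h) + w ≡ D j (suc (h + h))) (sym (gap-dist true {D j (h + h)} {D j (suc (h + h))} eq)) eq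

    X∞-pair : ∀ j → X∞ j + X∞ (suc j) ≤ t ∸ ∑ m s
    X∞-pair j with mid (D-inv j)
    ... | x , x≤ , eq with mid-step j (D j) x (stable (D-inv j) (h + h) (≤-trans mh (n≤1+n _))) x≤ eq
    ...   | d , d≤ , eq′ rewrite gap-dist true {D j (h + h)} {D j (suc (h + h))} eq
                  | gap-dist true {D (suc j) (h + h)} {D (suc j) (suc (h + h))} eq′ =
      ≤-trans (≤-reflexive (+-comm x d)) (∸-room x≤ d≤)

    Telescope : Bool → ℕ → ℕ → ℕ → ℕ → Set
    Telescope true  p b a e = p + e ≡ b + a
    Telescope false p b a e = p + a ≡ b + e

    -- The even classes add up to the last even prefix, the odd ones to `c j` minus the last odd
    -- prefix. The parity of `N` tells which of `D j N` and `D j (suc N)` is which.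
    telescope : ∀ j N → Telescope (even? N) (∑ (2 + N) (X j)) (c j) (D j N) (D j (suc N))
    telescope j zero = trans (D-one j) (sym (trans (cong (c j +_) (D-zero j)) (+-identityʳ _)))
    telescope j (suc N) rewrite even?-suc N with even? N | telescope j N | X-gap j N
    ... | true  | tel | g = begin
      ∑ (2 + N) (X j) + X j (2 + N) + D j (suc N) ≡⟨ perm (∑ (2 + N) (X j)) _ _ ⟩
      ∑ (2 + N) (X j) + D j (suc N) + X j (2 + N) ≡⟨ cong (_+ X j (2 + N)) tel ⟩
      c j + D j N + X j (2 + N)                   ≡⟨ +-assoc (c j) _ _ ⟩
      c j + (D j N + X j (2 + N))                 ≡⟨ cong (c j +_) g ⟩
      c j + D j (2 + N) ∎
      where
      open ≡-Reasoning
      perm : ∀ a b e → a + b + e ≡ a + e + b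
      perm = solve-∀
    ... | false | tel | g = begin
      ∑ (2 + N) (X j) + X j (2 + N) + D j (2 + N) ≡⟨ perm (∑ (2 + N) (X j)) _ _ ⟩
      ∑ (2 + N) (X j) + (D j (2 + N) + X j (2 + N)) ≡⟨ cong (∑ (2 + N) (X j) +_) g ⟩
      ∑ (2 + N) (X j) + D j N                     ≡⟨ tel ⟩
      c j + D j (suc N) ∎
      where
      open ≡-Reasoning
      perm : ∀ a b e → a + b + e ≡ a + (e + b)
      perm = solve-∀

    X-total : ∀ j → ∑ m (X j) + X∞ j ≡ c j
    X-total j = +-cancelˡ-≡ (D j (h + h)) _ _ (begin
      f + (∑ m (X j) + X∞ j)              ≡⟨ cong (λ w → f + (w + X∞ j)) (sym (∑-stable m (2 + (h + h))
                                               (λ o m≤o → n≤0⇒n≡0 (≤-trans (X-ahead j o) (≤-reflexive (ahead-≥ j m≤o))))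
                                               (≤-trans mh (n≤1+n _)))) ⟩
      f + (∑ (2 + (h + h)) (X j) + X∞ j)  ≡⟨ perm f _ (X∞ j) ⟩
      ∑ (2 + (h + h)) (X j) + (f + X∞ j)  ≡⟨ cong (∑ (2 + (h + h)) (X j) +_) (X∞-gap j) ⟩
      ∑ (2 + (h + h)) (X j) + D j (suc (h + h)) ≡⟨ subst (λ p → Telescope p (∑ (2 + (h + h)) (X j)) (c j) f (D j (suc (h + h))))
                                               (even?-double h) (telescope j (h + h)) ⟩
      c j + f                             ≡⟨ +-comm (c j) f ⟩
      f + c j ∎)
      where
      open ≡-Reasoning
      f : ℕ
      f = D j (h + h)
      perm : ∀ a b e → a + (b + e) ≡ b + (a + e)
      perm = solve-∀

    X-periodic : ∀ o → Periodic m (λ j → X j o)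
    X-periodic 0 j = refl
    X-periodic 1 j = refl
    X-periodic (suc (suc o)) j = cong₂ ∣_-_∣ (D-periodic j o) (D-periodic j (2 + o))

    X∞-periodic : Periodic m X∞
    X∞-periodic j = cong₂ ∣_-_∣ (D-periodic j (h + h)) (D-periodic j (suc (h + h)))

    z : ℕ
    z = t ∸ ∑ m s

    m-parity : (m ≡ h + h) ⊎ (m ≡ suc (h + h))
    m-parity with m≤n⇒m<n∨m≡n mh
    ... | inj₁ m<  = inj₁ (≤-antisym (≤-pred m<) hm)
    ... | inj₂ m≡ = inj₂ m≡

    even-sum : ∀ (y : ℕ → ℕ) b → (∀ j → y j + y (suc j) ≤ b) → m ≡ h + h → ∑ m y ≤ h * b
    even-sum y b pair m≡ = subst (λ w → ∑ w y ≤ h * b) (sym m≡) (∑-pairs h y b pair 0)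

    odd-sum : ∀ (y : ℕ → ℕ) b → Periodic m y → (∀ j → y j + y (suc j) ≤ b) → m ≡ suc (h + h) →
              ∀ a → y a ≡ 0 → ∑ m y ≤ h * b
    odd-sum y b per pair m≡ a ya = subst (λ w → ∑ w y ≤ h * b) (sym m≡)
      (∑-odd-cycle h y b (subst (λ w → Periodic w y) m≡ per) pair a ya)

    -- If class ∞ is used at every time, the greedy choice exhausts the classes before it each time, so class ∞
    -- carries only what the odd-cycle inequality for c leaves over.
    saturated-sum : h + h < m → (∀ j → 0 < X∞ j) → ∑ m X∞ ≤ h * z
    saturated-sum hh<m pos = +-cancelˡ-≤ (h * ∑ m s) _ _ (begin
      h * ∑ m s + ∑ m X∞   ≤⟨ +-cancelˡ-≤ (∑ m f) _ _ balance ⟩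
      ∑ m c                ≤⟨ c-total ⟩
      h * t                ≡⟨ cong (h *_) (m+[n∸m]≡n s-total) ⟨
      h * (∑ m s + z)      ≡⟨ *-distribˡ-+ h _ _ ⟩
      h * ∑ m s + h * z ∎)
      where
      open ≤-Reasoning
      f : ℕ → ℕ
      f j = D j (h + h)
      A : ℕ → ℕ
      A j = S (suc j) (h + h)

      tight : ∀ j → A j + (f j + X∞ j) ≤ c j + f (suc j)
      tight j with ≤-total (c (suc j)) ((up j (h + h) + D j (suc (h + h))) ∸ dn j (h + h))
      -- If the cap `c (suc j)` were attained before class ∞, nothing would be left for class ∞ at
      -- `j + 1`.
      ... | inj₁ c≤ = ⊥-elim (<-irrefl refl (begin-strict
            c (suc j)                  ≡⟨ m≤n⇒m⊓n≡m c≤ ⟨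
            f (suc j)                  <⟨ m<m+n (f (suc j)) (pos (suc j)) ⟩
            f (suc j) + X∞ (suc j)     ≡⟨ X∞-gap (suc j) ⟩
            D (suc j) (suc (h + h))    ≤⟨ cap (D-inv (suc j)) (suc (h + h)) ⟩
            c (suc j) ∎))
      ... | inj₂ ≤c rewrite m≥n⇒m⊓n≡n ≤c | even?-double h | X∞-gap j = m≤n+m∸n _ (c j)

      -- For each of the `h` even offsets, letting `j` go once around the rim meets every spoke
      -- once.
      spokes : ∑ m A ≡ h * ∑ m s
      spokes = begin-equality
        ∑ m A                                              ≡⟨ ∑-cong m (λ j _ → S-double (suc j) h hh<m) ⟩
        ∑ m (λ j → ∑ h (λ l → s (suc j + (2 + (l + l)))))  ≡⟨ ∑-swap m h _ ⟩
        ∑ h (λ l → ∑ m (λ j → s (suc j + (2 + (l + l)))))  ≡⟨ ∑-cong h (λ l _ → trans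
                                                                (∑-cong m (λ j _ → cong s (+-comm (suc j) _)))
                                                                (trans (∑-cong m (λ j _ → cong s (+-suc (2 + (l + l)) j)))
                                                                       (∑-rotate m s s-periodic (3 + (l + l))))) ⟩
        ∑ h (λ _ → ∑ m s)                                  ≡⟨ ∑-const h _ ⟩
        h * ∑ m s ∎

      balance : ∑ m f + (h * ∑ m s + ∑ m X∞) ≤ ∑ m f + ∑ m c
      balance = begin
        ∑ m f + (h * ∑ m s + ∑ m X∞)         ≡⟨ perm (∑ m f) (h * ∑ m s) (∑ m X∞) ⟩
        h * ∑ m s + (∑ m f + ∑ m X∞)         ≡⟨ cong₂ _+_ (sym spokes) (sym (∑-+ m f X∞)) ⟩
        ∑ m A + ∑ m (λ j → f j + X∞ j)       ≡⟨ ∑-+ m A _ ⟨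
        ∑ m (λ j → A j + (f j + X∞ j))       ≤⟨ ∑-mono m (λ j _ → tight j) ⟩
        ∑ m (λ j → c j + f (suc j))          ≡⟨ ∑-+ m c _ ⟩
        ∑ m c + ∑ m (λ j → f (suc j))        ≡⟨ cong (∑ m c +_) (∑-rotate m f (λ j → D-periodic j (h + h)) 1) ⟩
        ∑ m c + ∑ m f                        ≡⟨ +-comm (∑ m c) _ ⟩
        ∑ m f + ∑ m c ∎
        where
        perm : ∀ a b e → a + (b + e) ≡ b + (a + e)
        perm = solve-∀

    X∞-sum : ∑ m X∞ ≤ h * z
    X∞-sum with m-parity
    ... | inj₁ m≡ = even-sum X∞ z X∞-pair m≡
    ... | inj₂ m≡ with anyUpTo? (λ j → X∞ j ≟ 0) m
    ...   | yes (a , _ , Xa≡0) = odd-sum X∞ z X∞-periodic X∞-pair m≡ a Xa≡0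
    ...   | no none = saturated-sum (≤-reflexive (sym m≡))
              (λ j → n≢0⇒n>0 (λ X≡0 → none (j % m , m%n<n j m , trans (periodic-% X∞-periodic j) X≡0)))

    -- (k − j) mod m, using −1 ≡ 1 + n
    off : ℕ → ℕ → ℕ
    off k j = (k + (1 + n) * j) % m

    off-periodic : ∀ k → Periodic m (off k)
    off-periodic k j = trans (cong (_% m) (trans (cong (k +_) (*-distribˡ-+ (1 + n) j m)) (sym (+-assoc k _ _))))
      ([m+kn]%n≡m%n (k + (1 + n) * j) (1 + n) m)

    -- Advancing by one rim edge lowers the offset by one, except at offset 0, where spoke `k` meets
    -- rim edge `j` and `X` vanishes.
    off-pred : ∀ k j → off k j ≡ 0 ⊎ off k j ≡ suc (off k (suc j))
    off-pred k j = aux (off k j) refl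
      where
      a : ℕ
      a = k + (1 + n) * j
      next-off : off k (suc j) ≡ (off k j + (1 + n)) % m
      next-off = trans (cong (_% m) (perm k n j))
        (trans (%-distribˡ-+ a (1 + n) m) (cong (λ w → (a % m + w) % m) (m<n⇒m%n≡m (n<1+n (1 + n)))))
        where
        perm : ∀ k n j → k + (1 + n) * suc j ≡ k + (1 + n) * j + (1 + n)
        perm = solve-∀
      aux : ∀ o → off k j ≡ o → off k j ≡ 0 ⊎ off k j ≡ suc (off k (suc j))
      aux zero    eq = inj₁ eq
      aux (suc p) eq = inj₂ (trans eq (cong suc (sym (trans next-off (trans (cong (λ w → (w + (1 + n)) % m) eq)
        (trans (cong (_% m) (sym (+-suc p (1 + n)))) (trans ([m+n]%n≡m%n p m)
          (m<n⇒m%n≡m (<-trans (n<1+n p) (subst (_< m) eq (m%n<n a m)))))))))))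

    x : ℕ → ℕ → ℕ
    x k j = X j (off k j)

    off-zero : ∀ k → off k k ≡ 0
    off-zero k = trans (cong (_% m) (perm k n)) (m*n%n≡0 k m)
      where
      perm : ∀ k n → k + (1 + n) * k ≡ k * (2 + n)
      perm = solve-∀

    x-after : ∀ k → x k k ≡ 0
    x-after k = cong (X k) (off-zero k)

    x-before : ∀ k j → k ≡ suc j % m → x k j ≡ 0
    x-before k j refl with off-pred k j
    ... | inj₁ o≡0 = cong (X j) o≡0
    ... | inj₂ o≡suc = cong (X j) (trans o≡suc (cong suc
      (trans (%-distribˡ-+ (suc j % m) _ m) (trans (cong (λ w → (w + ((1 + n) * suc j) % m) % m) (m%n%n≡m%n (suc j) m))
      (trans (sym (%-distribˡ-+ (suc j) ((1 + n) * suc j) m)) (off-zero (suc j)))))))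

    ahead-off : ∀ k j → ahead j (off k j) ≡ s k
    ahead-off k j = begin
      ahead j (off k j)          ≡⟨ ahead-< j (m%n<n (k + (1 + n) * j) m) ⟩
      s (j + off k j)            ≡⟨ periodic-% {m} {λ w → s (j + w)} (λ i → trans (cong s (sym (+-assoc j i m))) (s-periodic (j + i))) _ ⟩
      s (j + (k + (1 + n) * j))  ≡⟨ cong s (perm j k n) ⟩
      s (k + j * m)              ≡⟨ periodic-* s-periodic j k ⟩
      s k ∎
      where
      open ≡-Reasoning
      perm : ∀ j k n → j + (k + (1 + n) * j) ≡ k + j * (2 + n)
      perm = solve-∀

    X-pair : ∀ j {o o′} → o ≡ 0 ⊎ o ≡ suc o′ → X j o + X (suc j) o′ ≤ ahead (suc j) o′
    X-pair j {o′ = o′} (inj₁ refl) = X-ahead (suc j) o′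
    X-pair j {o′ = o′} (inj₂ refl) = ≤-trans (≤-reflexive (+-comm (X j (suc o′)) (X (suc j) o′))) (X-cross j o′)

    x-pair : ∀ k j → x k j + x k (suc j) ≤ s k
    x-pair k j = ≤-trans (X-pair j (off-pred k j)) (≤-reflexive (ahead-off k (suc j)))

    x-periodic : ∀ k → Periodic m (x k)
    x-periodic k j = trans (cong (X (j + m)) (off-periodic k j)) (X-periodic (off k j) j)

    x-total : ∀ j → ∑ m (λ k → x k j) + X∞ j ≡ c j
    x-total j = trans (cong (_+ X∞ j) (begin
      ∑ m (λ k → x k j)              ≡⟨ ∑-cong m (λ k _ → cong (λ w → X j (w % m)) (+-comm k ((1 + n) * j))) ⟩
      ∑ m (λ k → g ((1 + n) * j + k)) ≡⟨ ∑-rotate m g (λ i → cong (X j) ([m+n]%n≡m%n i m)) ((1 + n) * j) ⟩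
      ∑ m g                          ≡⟨ ∑-cong m (λ k k<m → cong (X j) (m<n⇒m%n≡m k<m)) ⟩
      ∑ m (X j) ∎)) (X-total j)
      where
      open ≡-Reasoning
      g : ℕ → ℕ
      g k = X j (k % m)

    -- On an odd rim, the zero of layer `k` at rim edge `k` opens the cycle.
    x-sum : ∀ k → ∑ m (x k) ≤ h * s k
    x-sum k with m-parity
    ... | inj₁ m≡ = even-sum (x k) (s k) (x-pair k) m≡
    ... | inj₂ m≡ = odd-sum (x k) (s k) (x-periodic k) (x-pair k) m≡ k (x-after k)

    layers : Layers m t h c s
    layers = record
      { x = x ; x∞ = X∞ ; x-periodic = x-periodic ; x∞-periodic = X∞-periodic
      ; x-pair = x-pair ; x∞-pair = X∞-pair ; x-after = x-after ; x-before = x-before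
      ; x-total = x-total ; x-sum = x-sum ; x∞-sum = X∞-sum }

  layers : Layers m t h c s
  layers = let (u₀ , I₀ , fix) = fixed in Extract.layers u₀ I₀ fix

-- The fractional solution given by a single matching

module _ (m : ℕ) (s : ℕ → ℕ) where
  open Ahead m s

  S-shift-even : ∀ j o → even? o ≡ true → S j (suc o) ≤ S (suc j) o
  S-shift-even j zero e = z≤n
  S-shift-even j (suc (suc o)) e = +-mono-≤ (S-shift-even j o e) (ahead-step j (2 + o))

  ahead-shift : Periodic m s → ∀ j → s j ≡ 0 → ∀ l → ahead (suc j) l ≤ ahead j (suc l)
  ahead-shift per j sj≡0 l with l <? m
  ... | no _ = z≤n
  ... | yes l<m with m≤n⇒m<n∨m≡n l<m
  ...   | inj₁ l+<m rewrite ahead-< j l+<m = ≤-reflexive (cong s (sym (+-suc j l)))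
  ...   | inj₂ refl = ≤-trans (≤-reflexive (trans (cong s (sym (+-suc j l))) (trans (per j) sj≡0))) z≤n

  -- The offsets 2, 4, ..., `suc o` from `j` are 1, 3, ..., `o` from `j + 1`. The inequality runs
  -- against `ahead-step`; spoke `j` is the only one the shift can lose, hence `s j ≡ 0`.
  S-shift-odd : Periodic m s → 2 ≤ m → ∀ j → s j ≡ 0 → ∀ o → even? o ≡ false → s (2 + j) + S (suc j) o ≤ S j (suc o)
  S-shift-odd per 2≤m j sj≡0 1 e = ≤-trans (≤-reflexive (trans (+-identityʳ _)
    (trans (cong s (sym (cong suc (+-comm j 1)))) (sym (ahead-< (suc j) 2≤m))))) (ahead-shift per j sj≡0 1)
  S-shift-odd per 2≤m j sj≡0 (suc (suc o)) e = ≤-trans (≤-reflexive (sym (+-assoc (s (2 + j)) _ _)))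
    (+-mono-≤ (S-shift-odd per 2≤m j sj≡0 o e) (ahead-shift per j sj≡0 (2 + o)))

  S-bound : Periodic m s → 2 ≤ m → ∀ j o → s j + s (suc j) + S j o ≤ ∑ m s
  S-bound per 2≤m j o with ≤-total m (2 + o)
  ... | inj₁ m≤ = ≤-trans (+-monoʳ-≤ (s j + s (suc j)) (m≤m+n (S j o) _)) (≤-reflexive (S-total per j o 2≤m m≤))
  ... | inj₂ ≤m = begin
    s j + s (suc j) + S j o
      ≤⟨ +-monoʳ-≤ (s j + s (suc j)) (m≤m+n (S j o) _) ⟩
    s j + s (suc j) + (S j o + S j (suc o))
      ≡⟨ cong (_+ (S j o + S j (suc o))) (cong₂ _+_
           (trans (ahead-< j (≤-trans (s≤s z≤n) 2≤m)) (cong s (+-identityʳ j)))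
           (trans (ahead-< j 2≤m) (cong s (+-comm j 1)))) ⟨
    ahead j 0 + ahead j 1 + (S j o + S j (suc o))
      ≡⟨ S-sum j o ⟨
    ∑ (2 + o) (ahead j)
      ≤⟨ ∑-≤-length (ahead j) ≤m ⟩
    ∑ m (ahead j)
      ≡⟨ ahead-total per j m ≤-refl ⟩
    ∑ m s ∎
    where open ≤-Reasoning

module _ {m h : ℕ} {c s : ℕ → ℕ} (2≤m : 2 ≤ m) (mh : m ≤ suc (h + h))
         (c-per : Periodic m c) (s-per : Periodic m s)
         (rims : ∀ j → c j + c (suc j) ≤ 1) (left : ∀ j → c j + s j ≤ 1) (right : ∀ j → c j + s (suc j) ≤ 1)
         (spokes : ∑ m s ≤ 1) where
  open Ahead m s
  open Update m 1 c s

  private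
    -- `S j o` is 0 or 1 here, so this is the indicator that the matching uses rim edge `j` and that
    -- its spoke, or the lack of one, belongs to the prefix `o`.
    Y : ℕ → ℕ → ℕ
    Y j o = if even? o then c j * S j o else c j * (1 ∸ S j o)

    S≤1 : ∀ j o → S j o ≤ 1
    S≤1 j o = ≤-trans (m≤n+m _ _) (≤-trans (S-bound m s s-per 2≤m j o) spokes)

    c≤1 : ∀ j → c j ≤ 1
    c≤1 j = ≤-trans (m≤m+n _ _) (rims j)

    Y-cap : ∀ j o → Y j o ≤ 1 * c j
    Y-cap j o rewrite *-identityˡ (c j) with even? o
    ... | true  = ≤-trans (*-monoʳ-≤ (c j) (S≤1 j o)) (≤-reflexive (*-identityʳ _))
    ... | false = ≤-trans (*-monoʳ-≤ (c j) (m∸n≤m 1 (S j o))) (≤-reflexive (*-identityʳ _))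

    bit : ∀ {a} → a ≤ 1 → a ≡ 0 ⊎ a ≡ 1
    bit z≤n       = inj₁ refl
    bit (s≤s z≤n) = inj₂ refl

    exclude : ∀ {a b} → a + b ≤ 1 → a ≡ 1 → b ≡ 0
    exclude a+b≤1 refl = n≤0⇒n≡0 (≤-pred a+b≤1)

    even-step : ∀ a a′ A B → a + a′ ≤ 1 → B ≤ A → a′ * A + a ≤ A + a * (1 ∸ B)
    even-step a a′ A B a+a′ B≤A with bit (≤-trans (m≤m+n a a′) a+a′)
    ... | inj₁ refl rewrite +-identityʳ (a′ * A) | +-identityʳ A =
      ≤-trans (*-monoˡ-≤ A a+a′) (≤-reflexive (*-identityˡ A))
    ... | inj₂ refl rewrite exclude a+a′ refl | +-identityʳ (1 ∸ B) =
      ≤-trans (m≤n+m∸n 1 B) (+-monoˡ-≤ (1 ∸ B) B≤A)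

    odd-step : ∀ j o → even? o ≡ false →
               c (suc j) * (1 ∸ S (suc j) o) + (c j + (s (suc j) + s (2 + j)) + S (suc j) o) ≤ 1 + c j * S j (suc o)
    odd-step j o odd with bit (c≤1 j) | bit (c≤1 (suc j))
    ... | inj₂ cj | _ rewrite exclude (rims j) cj | exclude (right j) cj | cj | *-identityˡ (S j (suc o)) =
      s≤s (S-shift-odd m s s-per 2≤m j (exclude (left j) cj) o odd)
    ... | inj₁ cj | inj₂ cj′ rewrite exclude (left (suc j)) cj′ | exclude (right (suc j)) cj′ | cj | cj′
                              | *-identityˡ (1 ∸ S (suc j) o) = ≤-reflexive (m∸n+n≡m (S≤1 (suc j) o))
    ... | inj₁ cj | inj₁ cj′ rewrite cj | cj′ = ≤-trans (S-bound m s s-per 2≤m (suc j) o) spokes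

    Y-step : ∀ j o → Y (suc j) o + 1 * dn j o ≤ 1 * up j o + Y j (suc o)
    Y-step j o rewrite *-identityˡ (dn j o) | *-identityˡ (up j o) | even?-suc o with even? o in eq
    ... | true  = even-step (c j) (c (suc j)) (S (suc j) o) (S j (suc o)) (rims j) (S-shift-even m s j o eq)
    ... | false = odd-step j o eq

    -- Adding `rims` around the rim bounds twice the sum by `m ≤ suc (h + h)`; integrality rounds
    -- this down to the odd-cycle inequality.
    c-half : ∑ m c ≤ h * 1
    c-half rewrite *-identityʳ h with ∑ m c ≤? h
    ... | yes p = p
    ... | no ¬p = ⊥-elim (<-irrefl refl (begin-strict
      suc (h + h)                       <⟨ n<1+n _ ⟩
      suc (suc (h + h))                 ≡⟨ cong suc (+-suc h h) ⟨
      suc h + suc h                     ≤⟨ +-mono-≤ (≰⇒> ¬p) (≰⇒> ¬p) ⟩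
      ∑ m c + ∑ m c                     ≡⟨ cong (∑ m c +_) (∑-rotate m c c-per 1) ⟨
      ∑ m c + ∑ m (λ j → c (suc j))     ≡⟨ ∑-+ m c _ ⟨
      ∑ m (λ j → c j + c (suc j))       ≤⟨ ∑-mono m (λ j _ → rims j) ⟩
      ∑ m (λ _ → 1)                     ≡⟨ trans (∑-const m 1) (*-identityʳ m) ⟩
      m                                 ≤⟨ mh ⟩
      suc (h + h) ∎))
      where open ≤-Reasoning

  fractional-single : Fractional m 1 h 1 c s
  fractional-single = record
    { Y = Y ; c-periodic = c-per ; s-periodic = s-per
    ; Y-periodic = Y-per ; Y-cap = Y-cap
    ; Y-full = λ j → *-comm (c j) 1
    ; Y-step = Y-step ; s-total = spokes ; c-total = c-half }
    where
    Y-per : ∀ j o → Y (j + m) o ≡ Y j o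
    Y-per j o with even? o
    ... | true  = cong₂ _*_ (c-per j) (S-periodic s-per j o)
    ... | false = cong₂ _*_ (c-per j) (cong (1 ∸_) (S-periodic s-per j o))

-- Adding and rescaling fractional solutions

S-zero : ∀ m j o → Ahead.S m (λ _ → 0) j o ≡ 0
S-zero m j 0 = refl
S-zero m j 1 = refl
S-zero m j (suc (suc o)) = trans (cong₂ _+_ (S-zero m j o) (az (2 + o))) refl
  where
  az : ∀ o → Ahead.ahead m (λ _ → 0) j o ≡ 0
  az o with o <? m
  ... | yes _ = refl
  ... | no  _ = refl

fractional-none : ∀ m h → Fractional m 0 h 1 (λ _ → 0) (λ _ → 0)
fractional-none m h = record
  { Y = λ _ _ → 0 ; c-periodic = λ _ → refl ; s-periodic = λ _ → refl ; Y-periodic = λ _ _ → refl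
  ; Y-cap = λ _ _ → z≤n ; Y-full = λ _ → refl ; Y-step = step
  ; s-total = ≤-reflexive zero-sum ; c-total = ≤-trans (≤-reflexive zero-sum) z≤n }
  where
  open Update m 0 (λ _ → 0) (λ _ → 0)
  zero-sum : ∑ m (λ _ → 0) ≡ 0
  zero-sum = trans (∑-const m 0) (*-zeroʳ m)
  step : ∀ j o → 1 * dn j o ≤ 1 * up j o + 0
  step j o with even? o
  ... | true  = z≤n
  ... | false rewrite S-zero m (suc j) o = z≤n

S-+ : ∀ m (s s′ : ℕ → ℕ) j o → Ahead.S m (λ i → s i + s′ i) j o ≡ Ahead.S m s j o + Ahead.S m s′ j o
S-+ m s s′ j 0 = refl
S-+ m s s′ j 1 = refl
S-+ m s s′ j (suc (suc o)) = trans (cong₂ _+_ (S-+ m s s′ j o) (ahead-+ (2 + o)))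
  (swap (Ahead.S m s j o) (Ahead.S m s′ j o) (Ahead.ahead m s j (2 + o)) (Ahead.ahead m s′ j (2 + o)))
  where
  ahead-+ : ∀ o → Ahead.ahead m (λ i → s i + s′ i) j o ≡ Ahead.ahead m s j o + Ahead.ahead m s′ j o
  ahead-+ o with o <? m
  ... | yes _ = refl
  ... | no  _ = refl
  swap : ∀ a b d e → a + b + (d + e) ≡ a + d + (b + e)
  swap = solve-∀

-- The conditions are jointly linear in `Y`, `t`, `c` and `s`.
fractional-plus : ∀ {m t t′ h c c′ s s′} → Fractional m t h 1 c s → Fractional m t′ h 1 c′ s′ →
                  Fractional m (t + t′) h 1 (λ j → c j + c′ j) (λ j → s j + s′ j)
fractional-plus {m} {t} {t′} {h} {c} {c′} {s} {s′} F F′ = record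
  { Y = λ j o → F.Y j o + F′.Y j o
  ; c-periodic = λ j → cong₂ _+_ (F.c-periodic j) (F′.c-periodic j)
  ; s-periodic = λ j → cong₂ _+_ (F.s-periodic j) (F′.s-periodic j)
  ; Y-periodic = λ j o → cong₂ _+_ (F.Y-periodic j o) (F′.Y-periodic j o)
  ; Y-cap  = λ j o → ≤-trans (+-mono-≤ (F.Y-cap j o) (F′.Y-cap j o)) (≤-reflexive (sym (*-distribˡ-+ 1 (c j) (c′ j))))
  ; Y-full = λ j → trans (cong₂ _+_ (F.Y-full j) (F′.Y-full j)) (sym (*-distribˡ-+ 1 (c j) (c′ j)))
  ; Y-step = step
  ; s-total = ≤-trans (≤-reflexive (∑-+ m s s′)) (+-mono-≤ F.s-total F′.s-total)
  ; c-total = ≤-trans (≤-reflexive (∑-+ m c c′)) (≤-trans (+-mono-≤ F.c-total F′.c-total) (≤-reflexive (sym (*-distribˡ-+ h t t′)))) }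
  where
  module F  = Fractional F
  module F′ = Fractional F′
  module U  = Update m t c s
  module U′ = Update m t′ c′ s′
  open Update m (t + t′) (λ j → c j + c′ j) (λ j → s j + s′ j)
  up-+ : ∀ j o → up j o ≡ U.up j o + U′.up j o
  up-+ j o with even? o
  ... | true  = S-+ m s s′ (suc j) o
  ... | false = refl
  perm : ∀ a a′ p p′ q q′ A A′ → a + a′ + (p + p′ + (q + q′)) + (A + A′) ≡ (a + (p + q) + A) + (a′ + (p′ + q′) + A′)
  perm = solve-∀
  dn-+ : ∀ j o → dn j o ≡ U.dn j o + U′.dn j o
  dn-+ j o with even? o
  ... | true  = refl
  ... | false = trans (cong (c j + c′ j + (s (suc j) + s′ (suc j) + (s (2 + j) + s′ (2 + j))) +_) (S-+ m s s′ (suc j) o))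
      (perm (c j) (c′ j) (s (suc j)) (s′ (suc j)) (s (2 + j)) (s′ (2 + j)) _ _)
  swap : ∀ a b d e → a + b + 1 * (d + e) ≡ (a + 1 * d) + (b + 1 * e)
  swap = solve-∀
  swap′ : ∀ a b d e → (1 * a + d) + (1 * b + e) ≡ 1 * (a + b) + (d + e)
  swap′ = solve-∀
  open ≤-Reasoning
  step : ∀ j o → F.Y (suc j) o + F′.Y (suc j) o + 1 * dn j o ≤ 1 * up j o + (F.Y j (suc o) + F′.Y j (suc o))
  step j o = begin
    F.Y (suc j) o + F′.Y (suc j) o + 1 * dn j o
      ≡⟨ cong (λ w → F.Y (suc j) o + F′.Y (suc j) o + 1 * w) (dn-+ j o) ⟩
    F.Y (suc j) o + F′.Y (suc j) o + 1 * (U.dn j o + U′.dn j o)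
      ≡⟨ swap (F.Y (suc j) o) _ (U.dn j o) _ ⟩
    (F.Y (suc j) o + 1 * U.dn j o) + (F′.Y (suc j) o + 1 * U′.dn j o)
      ≤⟨ +-mono-≤ (F.Y-step j o) (F′.Y-step j o) ⟩
    (1 * U.up j o + F.Y j (suc o)) + (1 * U′.up j o + F′.Y j (suc o))
      ≡⟨ swap′ (U.up j o) _ (F.Y j (suc o)) _ ⟩
    1 * (U.up j o + U′.up j o) + (F.Y j (suc o) + F′.Y j (suc o))
      ≡⟨ cong (λ w → 1 * w + (F.Y j (suc o) + F′.Y j (suc o))) (up-+ j o) ⟨
    1 * up j o + (F.Y j (suc o) + F′.Y j (suc o)) ∎

S-scale : ∀ m Q {s s′ : ℕ → ℕ} → (∀ i → s′ i ≡ Q * s i) → ∀ j o → Ahead.S m s′ j o ≡ Q * Ahead.S m s j o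
S-scale m Q eq j 0 = sym (*-zeroʳ Q)
S-scale m Q eq j 1 = sym (*-zeroʳ Q)
S-scale m Q {s} {s′} eq j (suc (suc o)) = trans (cong₂ _+_ (S-scale m Q eq j o) (ahead-scale (2 + o)))
  (sym (*-distribˡ-+ Q _ _))
  where
  ahead-scale : ∀ o → Ahead.ahead m s′ j o ≡ Q * Ahead.ahead m s j o
  ahead-scale o with o <? m
  ... | yes _ = eq (j + o)
  ... | no  _ = sym (*-zeroʳ Q)

-- A collection of `Q * t` matchings, each read with weight 1 / Q, has total weight `t`. `Y` stays
-- as it is, since `Fractional` measures it in units of 1 / Q.
rescale : ∀ {m T t h Q c c′ s s′} .{{_ : NonZero Q}} → T ≡ Q * t → (∀ j → c′ j ≡ Q * c j) → (∀ j → s′ j ≡ Q * s j) →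
          Fractional m T h 1 c′ s′ → Fractional m t h Q c s
rescale {m} {T} {t} {h} {Q} {c} {c′} {s} {s′} T≡ c≡ s≡ F = record
  { Y = Y ; Y-periodic = Y-periodic
  ; c-periodic = λ j → *-cancelˡ-≡ _ _ Q (trans (sym (c≡ (j + m))) (trans (c-periodic j) (c≡ j)))
  ; s-periodic = λ j → *-cancelˡ-≡ _ _ Q (trans (sym (s≡ (j + m))) (trans (s-periodic j) (s≡ j)))
  ; Y-cap  = λ j o → ≤-trans (Y-cap j o) (≤-reflexive (trans (*-identityˡ (c′ j)) (c≡ j)))
  ; Y-full = λ j → trans (Y-full j) (trans (*-identityˡ (c′ j)) (c≡ j))
  ; Y-step = λ j o → subst₂ (λ d u → Y (suc j) o + d ≤ u + Y j (suc o))
      (trans (*-identityˡ (U.dn j o)) (dn-scale j o)) (trans (*-identityˡ (U.up j o)) (up-scale j o)) (Y-step j o)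
  ; s-total = *-cancelˡ-≤ Q (subst₂ _≤_ (∑-* m Q s≡) T≡ s-total)
  ; c-total = *-cancelˡ-≤ Q (subst₂ _≤_ (∑-* m Q c≡) (trans (cong (h *_) T≡) (perm h Q t)) c-total) }
  where
  open Fractional F
  module U = Update m T c′ s′
  open Update m t c s
  perm : ∀ a b e → a * (b * e) ≡ b * (a * e)
  perm = solve-∀
  up-scale : ∀ j o → U.up j o ≡ Q * up j o
  up-scale j o with even? o
  ... | true  = S-scale m Q s≡ (suc j) o
  ... | false = T≡
  dist : ∀ Q a p q A → Q * a + (Q * p + Q * q) + Q * A ≡ Q * (a + (p + q) + A)
  dist = solve-∀
  dn-scale : ∀ j o → U.dn j o ≡ Q * dn j o
  dn-scale j o with even? o
  ... | true  = c≡ j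
  ... | false = trans (cong₂ _+_ (cong₂ _+_ (c≡ j) (cong₂ _+_ (s≡ (suc j)) (s≡ (2 + j)))) (S-scale m Q s≡ (suc j) o))
                      (dist Q (c j) (s (suc j)) (s (2 + j)) _)

-- Clearing denominators

b2n : Bool → ℕ
b2n b = if b then 1 else 0

count : {A : Set} → (A → Bool) → List A → ℕ
count f []       = 0
count f (x ∷ xs) = b2n (f x) + count f xs

count-++ : {A : Set} (f : A → Bool) (xs ys : List A) → count f (xs ++ ys) ≡ count f xs + count f ys
count-++ f []       ys = refl
count-++ f (x ∷ xs) ys = trans (cong (b2n (f x) +_) (count-++ f xs ys)) (sym (+-assoc (b2n (f x)) _ _))

repeat : {A : Set} → ℕ → List A → List A
repeat zero    xs = []
repeat (suc n) xs = xs ++ repeat n xs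

count-repeat : {A : Set} (f : A → Bool) (n : ℕ) (xs : List A) → count f (repeat n xs) ≡ n * count f xs
count-repeat f zero    xs = refl
count-repeat f (suc n) xs = trans (count-++ f xs (repeat n xs)) (cong (count f xs +_) (count-repeat f n xs))

toℚᵘ-ℤ→ℚ : ∀ z → toℚᵘ (ℤ→ℚ z) ℚᵘ.≃ mkℚᵘ z 0
toℚᵘ-ℤ→ℚ z = ℚₚ.toℚᵘ-fromℚᵘ (mkℚᵘ z 0)

ℤ→ℚ-injective : ∀ a b → ℤ→ℚ a ≡ ℤ→ℚ b → a ≡ b
ℤ→ℚ-injective a b eq with ℚᵘₚ.≃-trans (ℚᵘₚ.≃-sym (toℚᵘ-ℤ→ℚ a)) (ℚᵘₚ.≃-trans (ℚᵘₚ.≃-reflexive (cong toℚᵘ eq)) (toℚᵘ-ℤ→ℚ b))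
... | *≡* eq′ = trans (sym (ℤₚ.*-identityʳ a)) (trans eq′ (ℤₚ.*-identityʳ b))

ℤ→ℚ-* : ∀ a b → ℤ→ℚ (a ℤ.* b) ≡ ℤ→ℚ a ℚ.* ℤ→ℚ b
ℤ→ℚ-* a b = ℚₚ.toℚᵘ-injective (begin
  toℚᵘ (ℤ→ℚ (a ℤ.* b))             ≈⟨ toℚᵘ-ℤ→ℚ (a ℤ.* b) ⟩
  mkℚᵘ a 0 ℚᵘ.* mkℚᵘ b 0           ≈⟨ ℚᵘₚ.*-cong (toℚᵘ-ℤ→ℚ a) (toℚᵘ-ℤ→ℚ b) ⟨
  toℚᵘ (ℤ→ℚ a) ℚᵘ.* toℚᵘ (ℤ→ℚ b)   ≈⟨ ℚₚ.toℚᵘ-homo-* (ℤ→ℚ a) (ℤ→ℚ b) ⟨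
  toℚᵘ (ℤ→ℚ a ℚ.* ℤ→ℚ b) ∎)
  where open ℚᵘₚ.≃-Reasoning

ℤ→ℚ-+ : ∀ a b → ℤ→ℚ (a ℤ.+ b) ≡ ℤ→ℚ a ℚ.+ ℤ→ℚ b
ℤ→ℚ-+ a b = ℚₚ.toℚᵘ-injective (begin
  toℚᵘ (ℤ→ℚ (a ℤ.+ b))             ≈⟨ toℚᵘ-ℤ→ℚ (a ℤ.+ b) ⟩
  mkℚᵘ (a ℤ.+ b) 0                 ≡⟨ cong₂ (λ u v → mkℚᵘ (u ℤ.+ v) 0) (ℤₚ.*-identityʳ a) (ℤₚ.*-identityʳ b) ⟨
  mkℚᵘ a 0 ℚᵘ.+ mkℚᵘ b 0           ≈⟨ ℚᵘₚ.+-cong (toℚᵘ-ℤ→ℚ a) (toℚᵘ-ℤ→ℚ b) ⟨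
  toℚᵘ (ℤ→ℚ a) ℚᵘ.+ toℚᵘ (ℤ→ℚ b)   ≈⟨ ℚₚ.toℚᵘ-homo-+ (ℤ→ℚ a) (ℤ→ℚ b) ⟨
  toℚᵘ (ℤ→ℚ a ℚ.+ ℤ→ℚ b) ∎)
  where open ℚᵘₚ.≃-Reasoning

ℕ→ℚ-* : ∀ a b → ℕ→ℚ (a * b) ≡ ℕ→ℚ a ℚ.* ℕ→ℚ b
ℕ→ℚ-* a b = trans (cong ℤ→ℚ (ℤₚ.pos-* a b)) (ℤ→ℚ-* (ℤ.+ a) (ℤ.+ b))

ℕ→ℚ-+ : ∀ a b → ℕ→ℚ (a + b) ≡ ℕ→ℚ a ℚ.+ ℕ→ℚ b
ℕ→ℚ-+ a b = ℤ→ℚ-+ (ℤ.+ a) (ℤ.+ b)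

b2q : Bool → ℚ
b2q b = if b then 1ℚ else 0ℚ

ℕ→ℚ-b2n : ∀ b → ℕ→ℚ (b2n b) ≡ b2q b
ℕ→ℚ-b2n true  = refl
ℕ→ℚ-b2n false = refl

clear-denominator : ∀ w → 0ℚ ℚ.≤ w → ∃ λ q → ∃ λ p → ℕ→ℚ (suc q) ℚ.* w ≡ ℕ→ℚ p
clear-denominator w@(mkℚ (ℤ.+ p) q _) 0≤w = q , p , ℚₚ.toℚᵘ-injective (begin
  toℚᵘ (ℕ→ℚ (suc q) ℚ.* w)            ≈⟨ ℚₚ.toℚᵘ-homo-* (ℕ→ℚ (suc q)) w ⟩
  toℚᵘ (ℕ→ℚ (suc q)) ℚᵘ.* toℚᵘ w      ≈⟨ ℚᵘₚ.*-cong (toℚᵘ-ℤ→ℚ (ℤ.+ suc q)) ℚᵘₚ.≃-refl ⟩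
  mkℚᵘ (ℤ.+ suc q) 0 ℚᵘ.* mkℚᵘ (ℤ.+ p) q ≈⟨ *≡* cross ⟩
  mkℚᵘ (ℤ.+ p) 0                       ≈⟨ toℚᵘ-ℤ→ℚ (ℤ.+ p) ⟨
  toℚᵘ (ℕ→ℚ p) ∎)
  where
  open ℚᵘₚ.≃-Reasoning
  cross : (ℤ.+ suc q ℤ.* ℤ.+ p) ℤ.* ℤ.+ 1 ≡ ℤ.+ p ℤ.* (ℤ.+ suc (q + 0))
  cross = trans (ℤₚ.*-identityʳ _) (trans (ℤₚ.*-comm (ℤ.+ suc q) (ℤ.+ p))
    (cong (λ k → ℤ.+ p ℤ.* ℤ.+ suc k) (sym (+-identityʳ q))))
clear-denominator w@(mkℚ (ℤ.-[1+ p ]) q _) (ℚ.*≤* ())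

weight : {A : Set} → (A → Bool) → List (ℚ × A) → ℚ
weight f L = sumℚ (map (λ p → proj₁ p ℚ.* b2q (f (proj₂ p))) L)

weight-true : {A : Set} (L : List (ℚ × A)) → weight (λ _ → true) L ≡ sumℚ (map proj₁ L)
weight-true []            = refl
weight-true ((w , _) ∷ L) = cong₂ ℚ._+_ (ℚₚ.*-identityʳ w) (weight-true L)

-- A weight p / (q + 1) turns into `p * Q` copies of its item, and the list built from the rest is
-- repeated `suc q` times. Quantifying over `f` covers the total weight and all edge coordinates
-- together.
clear-denominators : {A : Set} (L : List (ℚ × A)) → All (λ p → 0ℚ ℚ.≤ proj₁ p) L →
  ∃ λ Q → ∃ λ xs → 0 < Q × (∀ f → ℕ→ℚ Q ℚ.* weight f L ≡ ℕ→ℚ (count f xs))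
clear-denominators [] [] = 1 , [] , s≤s z≤n , λ f → ℚₚ.*-zeroʳ (ℕ→ℚ 1)
clear-denominators ((w , x) ∷ L) (0≤w ∷ 0≤L) with clear-denominator w 0≤w | clear-denominators L 0≤L
... | q , p , w-eq | Q , xs , Q>0 , eq =
  suc q * Q , repeat (p * Q) (x ∷ []) ++ repeat (suc q) xs , *-mono-≤ {1} {suc q} {1} {Q} (s≤s z≤n) Q>0 , λ f → begin
    ℕ→ℚ (suc q * Q) ℚ.* (w ℚ.* b2q (f x) ℚ.+ weight f L)
      ≡⟨ cong (ℚ._* (w ℚ.* b2q (f x) ℚ.+ weight f L)) (ℕ→ℚ-* (suc q) Q) ⟩
    (ℕ→ℚ (suc q) ℚ.* ℕ→ℚ Q) ℚ.* (w ℚ.* b2q (f x) ℚ.+ weight f L)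
      ≡⟨ rearrange (ℕ→ℚ (suc q)) (ℕ→ℚ Q) w (b2q (f x)) (weight f L) ⟩
    (ℕ→ℚ (suc q) ℚ.* w) ℚ.* ℕ→ℚ Q ℚ.* b2q (f x) ℚ.+ ℕ→ℚ (suc q) ℚ.* (ℕ→ℚ Q ℚ.* weight f L)
      ≡⟨ cong₂ ℚ._+_ (cong₂ ℚ._*_ (cong (ℚ._* ℕ→ℚ Q) w-eq) (sym (ℕ→ℚ-b2n (f x))))
                     (cong (ℕ→ℚ (suc q) ℚ.*_) (eq f)) ⟩
    ℕ→ℚ p ℚ.* ℕ→ℚ Q ℚ.* ℕ→ℚ (b2n (f x)) ℚ.+ ℕ→ℚ (suc q) ℚ.* ℕ→ℚ (count f xs)
      ≡⟨ cong₂ ℚ._+_ (trans (ℕ→ℚ-* (p * Q) (b2n (f x))) (cong (ℚ._* ℕ→ℚ (b2n (f x))) (ℕ→ℚ-* p Q))) (ℕ→ℚ-* (suc q) (count f xs)) ⟨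
    ℕ→ℚ (p * Q * b2n (f x)) ℚ.+ ℕ→ℚ (suc q * count f xs)
      ≡⟨ ℕ→ℚ-+ (p * Q * b2n (f x)) (suc q * count f xs) ⟨
    ℕ→ℚ (p * Q * b2n (f x) + suc q * count f xs)
      ≡⟨ cong ℕ→ℚ (cong₂ _+_ (trans (count-repeat f (p * Q) (x ∷ [])) (cong (p * Q *_) (+-identityʳ _)))
                                (count-repeat f (suc q) xs)) ⟨
    ℕ→ℚ (count f (repeat (p * Q) (x ∷ [])) + count f (repeat (suc q) xs))
      ≡⟨ cong ℕ→ℚ (count-++ f (repeat (p * Q) (x ∷ [])) _) ⟨
    ℕ→ℚ (count f (repeat (p * Q) (x ∷ []) ++ repeat (suc q) xs)) ∎
  where
  open ≡-Reasoning
  open +-*-Solver using (solve; _:*_; _:+_; _:=_)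
  rearrange : ∀ a b w i v → (a ℚ.* b) ℚ.* (w ℚ.* i ℚ.+ v) ≡ (a ℚ.* w) ℚ.* b ℚ.* i ℚ.+ a ℚ.* (b ℚ.* v)
  rearrange = solve 5 (λ a b w i v → (a :* b) :* (w :* i :+ v) := (a :* w) :* b :* i :+ a :* (b :* v)) refl

b2n≤1 : ∀ b → b2n b ≤ 1
b2n≤1 true  = ≤-refl
b2n≤1 false = z≤n

b2n-exclusive : ∀ a b → (T a → T b → ⊥) → b2n a + b2n b ≤ 1
b2n-exclusive true  true  ex = ⊥-elim (ex tt tt)
b2n-exclusive true  false ex = ≤-refl
b2n-exclusive false b     ex = b2n≤1 b

b2n-positive : ∀ n → n ≤ 1 → b2n (0 <ᵇ n) ≡ n
b2n-positive zero          n≤1 = refl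
b2n-positive (suc zero)    n≤1 = refl
b2n-positive (suc (suc n)) (s≤s ())

b2n-≡ᵇ : ∀ a → b2n (a ≡ᵇ a) ≡ 1
b2n-≡ᵇ zero    = refl
b2n-≡ᵇ (suc a) = b2n-≡ᵇ a

b2n-≢ : ∀ a b → a ≢ b → b2n (a ≡ᵇ b) ≡ 0
b2n-≢ a b a≢b with a ≡ᵇ b in eq
... | true  = ⊥-elim (a≢b (≡ᵇ⇒≡ a b (subst T (sym eq) tt)))
... | false = refl

∑-delta : ∀ n (s : ℕ → ℕ) i → i < n → ∑ n (λ k → s k * b2n (i ≡ᵇ k)) ≡ s i
∑-delta (suc n) s i i<1+n with m≤n⇒m<n∨m≡n (≤-pred i<1+n)
... | inj₁ i<n  = trans (cong₂ _+_ (∑-delta n s i i<n)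
      (trans (cong (s n *_) (b2n-≢ i n (<⇒≢ i<n))) (*-zeroʳ (s n)))) (+-identityʳ _)
... | inj₂ refl = cong₂ _+_ (trans (∑-cong n (λ k k<i → trans (cong (s k *_) (b2n-≢ i k (>⇒≢ k<i))) (*-zeroʳ (s k))))
      (trans (∑-const n 0) (*-zeroʳ n))) (trans (cong (s i *_) (b2n-≡ᵇ i)) (*-identityʳ _))

gather : {A : Set} → ℕ → (ℕ → List A) → List A
gather zero    f = []
gather (suc n) f = gather n f ++ f n

count-gather : {A : Set} (g : A → Bool) (n : ℕ) (f : ℕ → List A) → count g (gather n f) ≡ ∑ n (λ i → count g (f i))
count-gather g zero    f = refl
count-gather g (suc n) f = trans (count-++ g (gather n f) (f n)) (cong (_+ count g (f n)) (count-gather g n f))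

count-true : {A : Set} (xs : List A) → count (λ _ → true) xs ≡ length xs
count-true []       = refl
count-true (x ∷ xs) = cong suc (count-true xs)

<ᵇ-exclusive : ∀ a b → a + b ≤ 1 → T (0 <ᵇ a) → T (0 <ᵇ b) → ⊥
<ᵇ-exclusive (suc a) (suc b) (s≤s le) _ _ with subst (_≤ 0) (+-suc a b) le
... | ()

zero-off : ∀ {a} → a ≡ 0 → T (0 <ᵇ a) → ⊥
zero-off refl ()

half : ∀ m → ∃ λ h → h + h ≤ m × m ≤ suc (h + h)
half zero          = 0 , z≤n , z≤n
half (suc zero)    = 0 , z≤n , s≤s z≤n
half (suc (suc m)) with half m
... | h , lo , hi = suc h , subst (_≤ 2 + m) (cong suc (sym (+-suc h h))) (s≤s (s≤s lo))
                          , s≤s (subst (suc m ≤_) (cong suc (sym (+-suc h h))) (s≤s hi))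

nonneg-factor : ∀ q → 0 < q → ∀ z {u} → ℤ.+ q ℤ.* z ≡ ℤ.+ u → ℤ.+ ℤ.∣ z ∣ ≡ z
nonneg-factor q       _ (ℤ.+ z)    _  = refl
nonneg-factor (suc q) _ ℤ.-[1+ z ] ()

-- Matchings of the wheel

module _ (n : ℕ) where
  private
    m : ℕ
    m = 2 + n
    G : Graph
    G = Wheel (3 + n)

  -- Demands on the rim become periodic sequences on ℕ by reading indices modulo `m`.
  at : ℕ → Fin m
  at j = j mod m

  toℕ-at : ∀ j → toℕ (at j) ≡ j % m
  toℕ-at j = toℕ-fromℕ< (m%n<n j m)

  at-periodic : ∀ j → at (j + m) ≡ at j
  at-periodic j = toℕ-injective (trans (toℕ-at (j + m)) (trans ([m+n]%n≡m%n j m) (sym (toℕ-at j))))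

  at-toℕ : ∀ i → at (toℕ i) ≡ i
  at-toℕ i = toℕ-injective (trans (toℕ-at (toℕ i)) (m<n⇒m%n≡m (toℕ<n i)))

  toℕ-next : ∀ i → toℕ (next i) ≡ suc (toℕ i) % m
  toℕ-next i = toℕ-at (suc (toℕ i))

  next-at : ∀ j → next (at j) ≡ at (suc j)
  next-at j = toℕ-injective (trans (toℕ-next (at j)) (trans (cong (λ w → suc w % m) (toℕ-at j))
    (trans (%-distribˡ-+ 1 (j % m) m) (trans (cong (λ w → (1 % m + w) % m) (m%n%n≡m%n j m))
    (trans (sym (%-distribˡ-+ 1 j m)) (sym (toℕ-at (suc j))))))))

  next-cases : ∀ (i : Fin m) → (suc (toℕ i) < m × toℕ (next i) ≡ suc (toℕ i)) ⊎ (suc (toℕ i) ≡ m × toℕ (next i) ≡ 0)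
  next-cases i with m≤n⇒m<n∨m≡n (toℕ<n i)
  ... | inj₁ lt = inj₁ (lt , trans (toℕ-next i) (m<n⇒m%n≡m lt))
  ... | inj₂ eq = inj₂ (eq , trans (toℕ-next i) (trans (cong (_% m) eq) (n%n≡0 m)))

  next≢ : ∀ (i : Fin m) → i ≢ next i
  next≢ i eq with next-cases i
  ... | inj₁ (_ , e) = <-irrefl (trans (cong toℕ eq) e) (n<1+n _)
  ... | inj₂ (e , e′) with trans (cong suc (trans (sym e′) (sym (cong toℕ eq)))) e
  ...   | ()

  next-injective : ∀ (i j : Fin m) → next i ≡ next j → i ≡ j
  next-injective i j eq with next-cases i | next-cases j
  ... | inj₁ (_ , a) | inj₁ (_ , b) = toℕ-injective (suc-injective (trans (sym a) (trans (cong toℕ eq) b)))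
  ... | inj₂ (a , _) | inj₂ (b , _) = toℕ-injective (suc-injective (trans a (sym b)))
  ... | inj₁ (_ , a) | inj₂ (_ , b) = ⊥-elim (0≢1+n (trans (sym b) (trans (sym (cong toℕ eq)) a)))
  ... | inj₂ (_ , a) | inj₁ (_ , b) = ⊥-elim (0≢1+n (trans (sym a) (trans (cong toℕ eq) b)))

  module FromMatching (M : Matching G) where
    private
      on : E G → Bool
      on = proj₁ M
      c s : ℕ → ℕ
      c j = b2n (on (inj₁ (at j)))
      s j = b2n (on (inj₂ (at j)))

    rims : ∀ j → c j + c (suc j) ≤ 1
    rims j = b2n-exclusive _ _ λ p q → proj₂ M (inj₁ (at j)) (inj₁ (at (suc j)))
      (λ { eq → next≢ (at j) (trans (inj₁-injective eq) (sym (next-at j))) }) p q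
      (inj₁ (next (at j))) (inj₂ refl) (inj₁ (cong inj₁ (next-at j)))

    left : ∀ j → c j + s j ≤ 1
    left j = b2n-exclusive _ _ λ p q → proj₂ M (inj₁ (at j)) (inj₂ (at j)) (λ ()) p q
      (inj₁ (at j)) (inj₁ refl) (inj₁ refl)

    right : ∀ j → c j + s (suc j) ≤ 1
    right j = b2n-exclusive _ _ λ p q → proj₂ M (inj₁ (at j)) (inj₂ (at (suc j))) (λ ()) p q
      (inj₁ (at (suc j))) (inj₂ (cong inj₁ (sym (next-at j)))) (inj₁ refl)

    spokes : ∑ m s ≤ 1
    spokes = ∑-at-most-one m s (λ i _ → b2n≤1 _) λ i j i<j j<m → b2n-exclusive _ _ λ p q →
      proj₂ M (inj₂ (at i)) (inj₂ (at j))
        (λ eq → <⇒≢ i<j (trans (sym (trans (toℕ-at i) (m<n⇒m%n≡m (<-trans i<j j<m))))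
          (trans (cong Sum.[ toℕ , toℕ ] eq) (trans (toℕ-at j) (m<n⇒m%n≡m j<m)))))
        p q (inj₂ tt) (inj₂ refl) (inj₂ refl)

    fractional-matching : ∀ {h} → m ≤ suc (h + h) → Fractional m 1 h 1 c s
    fractional-matching mh = fractional-single (s≤s (s≤s z≤n)) mh
      (λ j → cong (λ i → b2n (on (inj₁ i))) (at-periodic j)) (λ j → cong (λ i → b2n (on (inj₂ i))) (at-periodic j))
      rims left right spokes

  uses : E G → List (Matching G) → ℕ
  uses e = count (λ M → proj₁ M e)

  fractional-list : ∀ {h} → m ≤ suc (h + h) → (Ms : List (Matching G)) →
    Fractional m (length Ms) h 1 (λ j → uses (inj₁ (at j)) Ms) (λ j → uses (inj₂ (at j)) Ms)
  fractional-list mh []       = fractional-none m _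
  fractional-list mh (M ∷ Ms) = fractional-plus (FromMatching.fractional-matching M mh) (fractional-list mh Ms)

  -- Assembling matchings from the layers

  toMatching : (rim spoke : Fin m → Bool) → (∀ i → T (rim i) → T (rim (next i)) → ⊥) →
               (∀ i → T (rim i) → T (spoke i) → ⊥) → (∀ i → T (rim i) → T (spoke (next i)) → ⊥) →
               (∀ i j → T (spoke i) → T (spoke j) → i ≡ j) → Matching G
  toMatching rim spoke rims left right one = on , isMatching
    where
    on : E G → Bool
    on = Sum.[ rim , spoke ]
    isMatching : IsMatching G on
    isMatching (inj₁ i) (inj₁ j) e≢f p q v (inj₁ refl) (inj₁ refl) = e≢f refl
    isMatching (inj₁ i) (inj₁ j) e≢f p q v (inj₁ refl) (inj₂ refl) = rims j q p
    isMatching (inj₁ i) (inj₁ j) e≢f p q v (inj₂ refl) (inj₁ refl) = rims i p q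
    isMatching (inj₁ i) (inj₁ j) e≢f p q v (inj₂ refl) (inj₂ eq) =
      e≢f (cong inj₁ (next-injective i j (cong Sum.[ (λ w → w) , (λ _ → i) ] eq)))
    isMatching (inj₁ i) (inj₂ j) e≢f p q v (inj₁ refl) (inj₁ refl) = left i p q
    isMatching (inj₁ i) (inj₂ j) e≢f p q v (inj₂ refl) (inj₁ refl) = right i p q
    isMatching (inj₂ i) (inj₁ j) e≢f p q v (inj₁ refl) (inj₁ refl) = left j q p
    isMatching (inj₂ i) (inj₁ j) e≢f p q v (inj₁ refl) (inj₂ refl) = right j q p
    isMatching (inj₂ i) (inj₁ j) e≢f p q v (inj₂ refl) (inj₁ ())
    isMatching (inj₂ i) (inj₁ j) e≢f p q v (inj₂ refl) (inj₂ ())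
    isMatching (inj₁ i) (inj₂ j) e≢f p q v (inj₁ refl) (inj₂ ())
    isMatching (inj₁ i) (inj₂ j) e≢f p q v (inj₂ refl) (inj₂ ())
    isMatching (inj₂ i) (inj₂ j) e≢f p q v _ _ = e≢f (cong inj₂ (one i j p q))

  module ToMatchings {t h : ℕ} {c s : ℕ → ℕ} (hm : h + h ≤ m) (s-total : ∑ m s ≤ t) (L : Layers m t h c s) where
    open Layers L

    split : ∀ k → RimSplit m (s k) (x k)
    split k = rim-split m (s k) (x k) h (x-periodic k 0) (x-pair k) hm (x-sum k)

    split∞ : RimSplit m (t ∸ ∑ m s) x∞
    split∞ = rim-split m (t ∸ ∑ m s) x∞ h (x∞-periodic 0) x∞-pair hm x∞-sum

    module _ {σ : ℕ} {z : ℕ → ℕ} (R : RimSplit m σ z) (r : ℕ) where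
      open RimSplit R
      rim : Fin m → Bool
      rim i = 0 <ᵇ β r (toℕ i)

      β-next : ∀ (i : Fin m) → β r (toℕ (next i)) ≡ β r (suc (toℕ i))
      β-next i with next-cases i
      ... | inj₁ (_ , e) = cong (β r) e
      ... | inj₂ (e , e′) = trans (cong (β r) e′) (trans (sym (wrap r)) (cong (β r) (sym e)))

      rim-excl : ∀ i → T (rim i) → T (rim (next i)) → ⊥
      rim-excl i = <ᵇ-exclusive (β r (toℕ i)) (β r (toℕ (next i))) (subst (λ w → β r (toℕ i) + w ≤ 1) (sym (β-next i)) (excl r (toℕ i)))

      rim-count : ∀ i → b2n (rim i) ≡ β r (toℕ i)
      rim-count i = b2n-positive _ (≤-trans (m≤m+n _ _) (excl r (toℕ i)))

    -- All `s k` colours of class `k` carry spoke `k`. Layer `k` is zero on the two rim edges at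
    -- vertex `k` by `x-after` and `x-before`, and `empty` passes this on to every single colour.
    colour : ℕ → ℕ → Matching G
    colour k r = toMatching (rim (split k) r) (λ i → toℕ i ≡ᵇ k) (rim-excl (split k) r)
      (λ i p q → zero-off (empty r (toℕ i) (trans (cong (x k) (≡ᵇ⇒≡ (toℕ i) k q)) (x-after k))) p)
      (λ i p q → zero-off (empty r (toℕ i) (x-before k (toℕ i)
                   (trans (sym (≡ᵇ⇒≡ (toℕ (next i)) k q)) (toℕ-next i)))) p)
      (λ i j p q → toℕ-injective (trans (≡ᵇ⇒≡ (toℕ i) k p) (sym (≡ᵇ⇒≡ (toℕ j) k q))))
      where open RimSplit (split k)

    colour∞ : ℕ → Matching G
    colour∞ r = toMatching (rim split∞ r) (λ _ → false) (rim-excl split∞ r) (λ _ _ ()) (λ _ _ ()) (λ _ _ ())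

    matchings : List (Matching G)
    matchings = gather m (λ k → gather (s k) (λ r → colour k r ∷ [])) ++ gather (t ∸ ∑ m s) (λ r → colour∞ r ∷ [])

    count-matchings : ∀ (g : Matching G → Bool) → count g matchings ≡
      ∑ m (λ k → ∑ (s k) (λ r → b2n (g (colour k r)))) + ∑ (t ∸ ∑ m s) (λ r → b2n (g (colour∞ r)))
    count-matchings g = trans (count-++ g (gather m _) _) (cong₂ _+_
      (trans (count-gather g m _) (∑-cong m (λ k _ → singles (s k) (colour k)))) (singles (t ∸ ∑ m s) colour∞))
      where
      singles : ∀ N (f : ℕ → Matching G) → count g (gather N (λ r → f r ∷ [])) ≡ ∑ N (λ r → b2n (g (f r)))
      singles N f = trans (count-gather g N _) (∑-cong N (λ r _ → +-identityʳ _))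

    length-matchings : length matchings ≡ t
    length-matchings = trans (sym (count-true matchings)) (trans (count-matchings (λ _ → true))
      (trans (cong₂ _+_ (∑-cong m (λ k _ → ones (s k))) (ones _)) (m+[n∸m]≡n s-total)))
      where
      ones : ∀ N → ∑ N (λ _ → 1) ≡ N
      ones N = trans (∑-const N 1) (*-identityʳ N)

    uses-rim : ∀ i → uses (inj₁ i) matchings ≡ c (toℕ i)
    uses-rim i = trans (count-matchings _) (trans (cong₂ _+_
      (∑-cong m (λ k _ → layer (split k))) (layer split∞)) (x-total (toℕ i)))
      where
      layer : ∀ {σ z} (R : RimSplit m σ z) → ∑ σ (λ r → b2n (rim R r i)) ≡ z (toℕ i)
      layer {σ} R = trans (∑-cong σ (λ r _ → rim-count R r i)) (RimSplit.counts R (toℕ i))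

    uses-spoke : ∀ i → uses (inj₂ i) matchings ≡ s (toℕ i)
    uses-spoke i = trans (count-matchings _) (trans (cong₂ _+_
      (trans (∑-cong m (λ k _ → ∑-const (s k) _)) (∑-delta m s (toℕ i) (toℕ<n i)))
      (trans (∑-const (t ∸ ∑ m s) 0) (*-zeroʳ (t ∸ ∑ m s)))) (+-identityʳ _))

  -- From an integer point of the dilated polytope to its decomposition

  round-matchings : ∀ t Q (a : E G → ℕ) (Ms : List (Matching G)) → 0 < Q →
    length Ms ≡ Q * t → (∀ e → uses e Ms ≡ Q * a e) →
    ∃ λ Ns → length Ns ≡ t × (∀ e → uses e Ns ≡ a e)
  round-matchings t Q a Ms Q>0 len uses≡ = matchings , length-matchings , uses-all
    where
    h : ℕ
    h = proj₁ (half m)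
    hm : h + h ≤ m
    hm = proj₁ (proj₂ (half m))
    mh : m ≤ suc (h + h)
    mh = proj₂ (proj₂ (half m))
    c s : ℕ → ℕ
    c j = a (inj₁ (at j))
    s j = a (inj₂ (at j))
    F : Fractional m t h Q c s
    F = rescale {{>-nonZero Q>0}} len (λ j → uses≡ (inj₁ (at j))) (λ j → uses≡ (inj₂ (at j))) (fractional-list mh Ms)
    open ToMatchings hm (Fractional.s-total F) (Solve.layers n t h Q c s Q>0 hm mh F)
    uses-all : ∀ e → uses e matchings ≡ a e
    uses-all (inj₁ i) = trans (uses-rim i) (cong (a ∘ inj₁) (at-toℕ i))
    uses-all (inj₂ i) = trans (uses-spoke i) (cong (a ∘ inj₂) (at-toℕ i))

  module _ (t : ℕ) (α : E G → ℤ) (L : List (ℚ × Matching G))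
           (total : sumℚ (map proj₁ L) ≡ ℕ→ℚ t)
           (coords : ∀ e → weight (λ M → proj₁ M e) L ≡ ℤ→ℚ (α e))
           (Q : ℕ) (Ms : List (Matching G))
           (cleared : ∀ f → ℕ→ℚ Q ℚ.* weight f L ≡ ℕ→ℚ (count f Ms)) where

    cleared-length : length Ms ≡ Q * t
    cleared-length = ℤₚ.+-injective (ℤ→ℚ-injective (ℤ.+ length Ms) (ℤ.+ (Q * t)) (begin
      ℕ→ℚ (length Ms)                     ≡⟨ cong ℕ→ℚ (count-true Ms) ⟨
      ℕ→ℚ (count (λ _ → true) Ms)         ≡⟨ cleared (λ _ → true) ⟨
      ℕ→ℚ Q ℚ.* weight (λ _ → true) L     ≡⟨ cong (ℕ→ℚ Q ℚ.*_) (trans (weight-true L) total) ⟩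
      ℕ→ℚ Q ℚ.* ℕ→ℚ t                     ≡⟨ ℕ→ℚ-* Q t ⟨
      ℕ→ℚ (Q * t) ∎))
      where open ≡-Reasoning

    cleared-edge : ∀ e → ℤ.+ Q ℤ.* α e ≡ ℤ.+ uses e Ms
    cleared-edge e = ℤ→ℚ-injective (ℤ.+ Q ℤ.* α e) (ℤ.+ uses e Ms) (begin
      ℤ→ℚ (ℤ.+ Q ℤ.* α e)                       ≡⟨ ℤ→ℚ-* (ℤ.+ Q) (α e) ⟩
      ℕ→ℚ Q ℚ.* ℤ→ℚ (α e)                       ≡⟨ cong (ℕ→ℚ Q ℚ.*_) (coords e) ⟨
      ℕ→ℚ Q ℚ.* weight (λ M → proj₁ M e) L      ≡⟨ cleared (λ M → proj₁ M e) ⟩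
      ℕ→ℚ (uses e Ms) ∎)
      where open ≡-Reasoning

  rounding : ∀ t (α : E G → ℤ) → InDilatedMatchingPolytope G t (λ e → ℤ→ℚ (α e)) →
    ∃ λ Ns → length Ns ≡ t × (∀ e → ℤ.+ uses e Ns ≡ α e)
  rounding t α (L , L≥0 , total , coords) =
    let (Q , Ms , Q>0 , cleared) = clear-denominators L L≥0
        edge = cleared-edge t α L total coords Q Ms cleared
        -- The rounding works over ℕ, so absolute values stand in for `α`. They agree with `α`
        -- because `Q` times each coordinate is a count, hence nonnegative.
        (Ns , len-Ns , uses-Ns) = round-matchings t Q (λ e → ℤ.∣ α e ∣) Ms Q>0
          (cleared-length t α L total coords Q Ms cleared)
          (λ e → trans (cong ℤ.∣_∣ (sym (edge e))) (ℤₚ.abs-* (ℤ.+ Q) (α e)))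
    in Ns , len-Ns , λ e → trans (cong ℤ.+_ (uses-Ns e)) (nonneg-factor Q Q>0 (α e) (edge e))

  vertex-in-polytope : (M : Matching G) → InMatchingPolytope G (λ e → ℤ→ℚ (ℤ.+ b2n (proj₁ M e)))
  vertex-in-polytope M = (1ℚ , M) ∷ [] , ℚ.*≤* (ℤ.+≤+ z≤n) ∷ [] , refl , λ e → coordinate (proj₁ M e)
    where
    coordinate : ∀ b → 1ℚ ℚ.* b2q b ℚ.+ 0ℚ ≡ ℤ→ℚ (ℤ.+ b2n b)
    coordinate true  = refl
    coordinate false = refl

  vertices : (Ns : List (Matching G)) → Vec (E G → ℤ) (length Ns)
  vertices []       = []
  vertices (N ∷ Ns) = (λ e → ℤ.+ b2n (proj₁ N e)) ∷ vertices Ns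

  vertices-in-polytope : ∀ Ns → VecAll.All (λ a → InMatchingPolytope G (λ e → ℤ→ℚ (a e))) (vertices Ns)
  vertices-in-polytope []       = []
  vertices-in-polytope (N ∷ Ns) = vertex-in-polytope N ∷ vertices-in-polytope Ns

  sum-vertices : ∀ Ns e → sumVecs (vertices Ns) e ≡ ℤ.+ uses e Ns
  sum-vertices []       e = refl
  sum-vertices (N ∷ Ns) e = cong (λ w → ℤ.+ b2n (proj₁ N e) ℤ.+ w) (sum-vertices Ns e)

  decompose : ∀ {t} {α : E G → ℤ} (Ns : List (Matching G)) → length Ns ≡ t → (∀ e → ℤ.+ uses e Ns ≡ α e) →
    ∃ λ (as : Vec (E G → ℤ) t) → VecAll.All (λ a → InMatchingPolytope G (λ e → ℤ→ℚ (a e))) as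
                                × (∀ e → sumVecs as e ≡ α e)
  decompose Ns refl uses≡ = vertices Ns , vertices-in-polytope Ns , λ e → trans (sum-vertices Ns e) (uses≡ e)

  wheel-idp : MatchingPolytopeHasIDP G
  wheel-idp t _ α inP = let (Ns , len , uses≡) = rounding t α inP in decompose Ns len uses≡

theorem4p10 : ∀ (n : ℕ) → 4 ≤ n → MatchingPolytopeHasIDP (Wheel n)
theorem4p10 (suc (suc (suc (suc n)))) (s≤s (s≤s (s≤s (s≤s _)))) = wheel-idp (suc n)
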